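{- Let $\Gamma$ be a connected simple graph of connectivity $1$, and let $\Lambda_0$ be an arbitrary lobe of $\Gamma$. Let $\{P_i : i\in\mathbb{I}\}$ be the set of orbits of $\mathrm{Aut}(\Gamma)$ acting on $V\Gamma$. Let $S\le \mathrm{Aut}(\Gamma)$ be the setwise stabilizer of $\Lambda_0$, and let $\{Q_j : j\in\mathbb{J}\}$ be the set of orbits of $S$ on $V\Gamma$ that are contained in $V\Lambda_0$. For each $j\in\mathbb{J}$ let $P_{i_j}$ denote the orbit of $\mathrm{Aut}(\Gamma)$ containing $Q_j$. Then $\Gamma$ is lobe-transitive (i.e. $\mathrm{Aut}(\Gamma)$ acts transitively on the set $\mathscr{L}(\Gamma)$ of lobes) if and only if the following hold: (1) there is a family of graph isomorphisms $\sigma_\Lambda:\Lambda_0\to\Lambda$, one for each lobe $\Lambda\in\mathscr{L}(\Gamma)$, such that (2) for each $j\in\mathbb{J}$, the function $\tau_j:V\Gamma\to\mathbb{N}\cup\{0,\aleph_0\}$ defined by $$\tau_j(v)=\bigl|\{\Lambda\in\mathscr{L}(\Gamma): v\in\sigma_\Lambda(Q_j)\}\bigr|$$ satisfies (a) $\tau_j$ is constant on $P_i$ for every $i\in\mathbb{I}$, and (b) for all $v\in V\Gamma$, $\tau_j(v)>0$ if and only if $v\in P_{i_j}$ (i.e. $v$ lies in the $\mathrm{Aut}(\Gamma)$-orbit that contains the sets $\sigma_\Lambda(Q_j)$).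
   Context: All graphs are simple, connected, and finite or countably infinite (so vertex valences are finite or countably infinite). For edges $e_1,e_2$ of $\Gamma$ write $e_1\cong e_2$ if $e_1=e_2$ or $e_1,e_2$ lie on a common cycle; this is an equivalence relation on $E\Gamma$. A lobe of $\Gamma$ is the subgraph induced by an equivalence class (equivalently, a cut-edge with its two end-vertices, or a maximal biconnected subgraph). $\mathscr{L}(\Gamma)$ is the set of lobes. A vertex is a cut vertex if it lies in at least two lobes; a connected graph other than $K_2$ has connectivity $1$ iff it has a cut vertex. $\mathbb{N}$ denotes the positive integers. -}

module Defs where

open import Level using (0ℓ)
open import Data.Fin using (Fin)
open import Data.List using (List; []; _∷_; _++_; _∷ʳ_; length)
open import Data.List.Relation.Unary.Linked using (Linked)
open import Data.List.Relation.Unary.Unique.Propositional using (Unique)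
open import Data.Nat using (ℕ; _≤_; _<_)
open import Data.Product using (Σ; Σ-syntax; ∃; ∃-syntax; _×_; _,_; proj₁)
open import Data.Sum using (_⊎_)
open import Data.Unit using (⊤)
open import Function.Bundles using (Inverse; _⇔_; Equivalence)
open import Function.Definitions using (Congruent; Bijective)
open import Relation.Binary.Bundles using (Setoid)
open import Relation.Binary.Construct.Closure.ReflexiveTransitive using (Star)
open import Relation.Binary.Core using (Rel)
open import Relation.Binary.PropositionalEquality using (_≡_; _≢_; refl; sym; setoid)
import Relation.Binary.Construct.On as On
open import Relation.Nullary using (¬_)
open import Relation.Unary using (Pred; _∈_; _⊆_; U)

data ℕ∪ℵ₀ : Set where
  fin : ℕ → ℕ∪ℵ₀
  ℵ₀  : ℕ∪ℵ₀

Positive : ℕ∪ℵ₀ → Set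
Positive (fin n) = 0 < n
Positive ℵ₀      = ⊤

-- HasCardinality A _≈_ c: there are exactly c elements of A up to _≈_.
HasCardinality : (A : Set) → Rel A 0ℓ → ℕ∪ℵ₀ → Set
HasCardinality A _≈_ (fin n) =
  Σ[ f ∈ (A → Fin n) ] Congruent _≈_ _≡_ f × Bijective _≈_ _≡_ f
HasCardinality A _≈_ ℵ₀ =
  Σ[ f ∈ (A → ℕ) ] Congruent _≈_ _≡_ f × Bijective _≈_ _≡_ f

record Graph : Set₁ where
  infix 4 _~_
  field
    V        : Set
    _~_      : Rel V 0ℓ
    ~-sym    : ∀ {u v} → u ~ v → v ~ u
    ~-irrefl : ∀ {v} → ¬ (v ~ v)

-- Vertices form a setoid because a vertex of a lobe is a vertex of the ambient
-- graph paired with a membership proof, which must be disregarded.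
record Isomorphism (A B : Setoid 0ℓ 0ℓ)
                   (_~ᴬ_ : Rel (Setoid.Carrier A) 0ℓ)
                   (_~ᴮ_ : Rel (Setoid.Carrier B) 0ℓ) : Set where
  field
    bijection : Inverse A B
  open Inverse bijection public using (to; from)
  field
    adjacency : ∀ u v → (u ~ᴬ v) ⇔ (to u ~ᴮ to v)

GraphIso : Graph → Graph → Set
GraphIso G H = Isomorphism (setoid (V G)) (setoid (V H)) (_~_ G) (_~_ H)
  where open Graph

Aut : Graph → Set
Aut Γ = GraphIso Γ Γ

K₂ : Graph
K₂ = record
  { V        = Fin 2
  ; _~_      = _≢_
  ; ~-sym    = λ u≢v v≡u → u≢v (sym v≡u)
  ; ~-irrefl = λ v≢v → v≢v refl
  }

module _ (Γ : Graph) where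
  open Graph Γ

  FiniteOrCountable : Set
  FiniteOrCountable = ∃[ c ] HasCardinality V _≡_ c

  Connected : Set
  Connected = ∀ u v → Star _~_ u v

  record Edge : Set where
    constructor edge
    field
      end₁ end₂ : V
      adjacent  : end₁ ~ end₂

module _ {Γ : Graph} where
  open Graph Γ
  open Edge

  -- Edges are unordered pairs.
  SameEdge : Rel (Edge Γ) 0ℓ
  SameEdge e f = (end₁ e ≡ end₁ f × end₂ e ≡ end₂ f)
               ⊎ (end₁ e ≡ end₂ f × end₂ e ≡ end₁ f)

  -- The cycle x , x₁ , … , xₙ , x, where xs = x₁ , … , xₙ and n ≥ 2.
  record IsCycle (x : V) (xs : List V) : Set where
    field
      closedWalk : Linked _~_ (x ∷ xs ∷ʳ x)
      distinct   : Unique (x ∷ xs)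
      long       : 2 ≤ length xs

  Consecutive : V → V → List V → Set
  Consecutive u v ws = ∃[ ps ] ∃[ qs ] ws ≡ ps ++ u ∷ v ∷ qs

  LiesOn : Edge Γ → List V → Set
  LiesOn e ws = Consecutive (end₁ e) (end₂ e) ws
              ⊎ Consecutive (end₂ e) (end₁ e) ws

  OnCommonCycle : Rel (Edge Γ) 0ℓ
  OnCommonCycle e f = ∃[ x ] ∃[ xs ]
    IsCycle x xs × LiesOn e (x ∷ xs ∷ʳ x) × LiesOn f (x ∷ xs ∷ʳ x)

  infix 4 _≅_
  _≅_ : Rel (Edge Γ) 0ℓ
  e ≅ f = SameEdge e f ⊎ OnCommonCycle e f

  mapEdge : Aut Γ → Edge Γ → Edge Γ
  mapEdge α (edge u v u~v) = edge (to u) (to v) (Equivalence.to (adjacency u v) u~v)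
    where open Isomorphism α

-- The set of lobes is the quotient of the edge set by ≅: the lobe determined by
-- the class of an edge is represented by that edge, and equality of lobes is ≅.
Lobe : Graph → Set
Lobe = Edge

module _ {Γ : Graph} where
  open Graph Γ
  open Edge

  ELobe : Lobe Γ → Pred (Edge Γ) 0ℓ
  ELobe Λ e = e ≅ Λ

  VLobe : Lobe Γ → Pred V 0ℓ
  VLobe Λ v = Σ[ e ∈ Edge Γ ] e ∈ ELobe Λ × (v ≡ end₁ e ⊎ v ≡ end₂ e)

  lobeVertices : Lobe Γ → Setoid 0ℓ 0ℓ
  lobeVertices Λ = On.setoid {B = Σ V (VLobe Λ)} (setoid V) proj₁

  lobeAdjacency : (Λ : Lobe Γ) → Rel (Σ V (VLobe Λ)) 0ℓ
  lobeAdjacency Λ (u , _) (v , _) = Σ[ u~v ∈ u ~ v ] edge u v u~v ∈ ELobe Λ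

  LobeIso : Lobe Γ → Lobe Γ → Set
  LobeIso Λ Λ′ = Isomorphism (lobeVertices Λ) (lobeVertices Λ′)
                             (lobeAdjacency Λ) (lobeAdjacency Λ′)

  -- α(Λ) = Λ′; as α is bijective on edges, this says that it carries the edge
  -- set of Λ onto that of Λ′.
  MapsOnto : Aut Γ → Lobe Γ → Lobe Γ → Set
  MapsOnto α Λ Λ′ = ∀ e → (e ∈ ELobe Λ) ⇔ (mapEdge α e ∈ ELobe Λ′)

  CutVertex : Pred V 0ℓ
  CutVertex v = Σ[ Λ ∈ Lobe Γ ] Σ[ Λ′ ∈ Lobe Γ ]
    ¬ (Λ ≅ Λ′) × v ∈ VLobe Λ × v ∈ VLobe Λ′

  Stabilizer : Lobe Γ → Pred (Aut Γ) 0ℓ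
  Stabilizer Λ α = MapsOnto α Λ Λ

  Orbit : Pred (Aut Γ) 0ℓ → V → Pred V 0ℓ
  Orbit H u v = Σ[ α ∈ Aut Γ ] α ∈ H × Isomorphism.to α u ≡ v

-- For a connected graph.
ConnectivityOne : Graph → Set
ConnectivityOne Γ = GraphIso Γ K₂ ⊎ ∃ (CutVertex {Γ})

LobeTransitive : Graph → Set
LobeTransitive Γ = (Λ Λ′ : Lobe Γ) → Σ[ α ∈ Aut Γ ] MapsOnto α Λ Λ′

-- An orbit P Γ i of Aut Γ is indexed by any vertex i in it.
P : (Γ : Graph) → Graph.V Γ → Pred (Graph.V Γ) 0ℓ
P Γ = Orbit {Γ} U

module _ {Γ : Graph} (Λ₀ : Lobe Γ) where
  open Graph Γ

  -- An orbit of the stabilizer of Λ₀ contained in Λ₀ is indexed by any vertex in it.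
  J : Set
  J = Σ[ q ∈ V ] Orbit {Γ} (Stabilizer Λ₀) q ⊆ VLobe Λ₀

  Q : J → Pred V 0ℓ
  Q (q , _) = Orbit {Γ} (Stabilizer Λ₀) q

  -- The Aut Γ-orbit containing Q j.
  PContaining : J → Pred V 0ℓ
  PContaining (q , _) = P Γ q

  record IsoFamily : Set where
    field
      σ             : (Λ : Lobe Γ) → LobeIso Λ₀ Λ
      -- σ depends on the lobe, not on the edge representing it.
      σ-wellDefined : ∀ Λ Λ′ → Λ ≅ Λ′ → ∀ x →
        proj₁ (Isomorphism.to (σ Λ) x) ≡ proj₁ (Isomorphism.to (σ Λ′) x)

    Image : Lobe Γ → Pred V 0ℓ → Pred V 0ℓ
    Image Λ X v = Σ[ x ∈ Σ V (VLobe Λ₀) ]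
      proj₁ x ∈ X × proj₁ (Isomorphism.to (σ Λ) x) ≡ v

    LobesThrough : J → V → Set
    LobesThrough j v = Σ[ Λ ∈ Lobe Γ ] v ∈ Image Λ (Q j)

    IsCount : J → (V → ℕ∪ℵ₀) → Set
    IsCount j τ = ∀ v →
      HasCardinality (LobesThrough j v) (λ Λ Λ′ → proj₁ Λ ≅ proj₁ Λ′) (τ v)

{-# OPTIONS --safe #-}

-- For the "if" direction, every lobe Θ through a vertex g has a type, the
-- Stab(Λ₀)-orbit of σ_Θ⁻¹(g), and τ_j(g) counts the lobes through g of type j.
-- If σ_Θ(p) = x and σ_Θ′(p′) = y with p, p′ in the same Stab(Λ₀)-orbit, then (b)
-- puts x and y in one Aut(Γ)-orbit, so by (a) equally many lobes of each type
-- pass through x and through y.  Hence an isomorphism Λ → Λ′ of the form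
-- σ_Λ′ s σ_Λ⁻¹ can be continued to the lobes attached at each vertex of Λ, and so
-- on outwards; as the lobes form a tree, this defines an automorphism of Γ.
-- Conversely, choose σ_Λ to be the restriction of an automorphism taking Λ₀ to Λ;
-- then v ∈ σ_Λ(Q_j) exactly when some automorphism carries Λ₀ to Λ and a given
-- point of Q_j to v, a condition that is invariant under Aut(Γ).
module Submission where

open import Defs
open import Level using (0ℓ)
open import Axiom.ExcludedMiddle using (ExcludedMiddle)
open import Data.Empty using (⊥-elim)
open import Data.Fin using (Fin; toℕ; fromℕ<)
open import Data.Fin.Properties
  using (toℕ<n; toℕ-injective; toℕ-fromℕ<; fromℕ<-injective; injective⇒≤; ℕ→Fin-notInjective)
open import Data.List using (List; []; _∷_; _++_; _∷ʳ_; length; map)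
open import Data.List.Membership.Propositional using () renaming (_∈_ to _∈ˡ_)
open import Data.List.Membership.Propositional.Properties using (∈-++⁺ʳ; ∈-++⁻; ∈-∃++)
open import Data.List.Properties using (++-assoc; map-++; length-map)
open import Data.List.Relation.Unary.All as All using (All; []; _∷_)
import Data.List.Relation.Unary.All.Properties as Allₚ
open import Data.List.Relation.Unary.AllPairs using ([]; _∷_)
open import Data.List.Relation.Unary.Any using (here; there)
open import Data.List.Relation.Unary.Linked as Linked using (Linked; []; [-]; _∷_)
import Data.List.Relation.Unary.Linked.Properties as Linkedₚ
open import Data.List.Relation.Unary.Unique.Propositional using (Unique)
import Data.List.Relation.Unary.Unique.Propositional.Properties as Uniqueₚ
open import Data.Nat using (ℕ; zero; suc; _+_; _*_; _≤_; _<_; z≤n; s≤s; _≟_)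
open import Data.Nat.Properties
  using (≤-refl; ≤-trans; ≤-antisym; <⇒≢; ≰⇒>; <-cmp; n<1+n; n≤1+n; m≤m+n; m<1+n⇒m<n∨m≡n;
         m≤n⇒m<n∨m≡n; +-comm; +-cancelˡ-≡; +-monoʳ-≤; *-monoʳ-<; *-mono-≤; module ≤-Reasoning)
open import Data.Product using (Σ; Σ-syntax; ∃; ∃-syntax; ∃₂; _×_; _,_; proj₁; proj₂)
open import Data.Sum as Sum using (_⊎_; inj₁; inj₂; [_,_]′)
open import Data.Unit using (⊤; tt)
open import Function using (_∘_; id)
open import Function.Bundles using (Inverse; _⇔_; Equivalence; mk⇔; mk↔ₛ′)
open import Relation.Binary.Construct.Closure.ReflexiveTransitive using (Star; ε; _◅_)
open import Relation.Binary.Core using (Rel)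
open import Relation.Binary.Definitions using (tri<; tri≈; tri>)
open import Relation.Binary.PropositionalEquality
  using (_≡_; _≢_; refl; sym; ≢-sym; trans; cong; cong₂; subst; subst₂; module ≡-Reasoning)
open import Relation.Nullary using (¬_; yes; no; contradiction)
open import Relation.Unary using (Pred; _∈_; U; _⊆_; _∖_)

-- Since `≅` is defined by common cycles, its transitivity has to be proved: it is shown to coincide
-- with `Inseparable`, the relation that no single vertex separates two edges, which composes at
-- once. The tree of lobes is never built as an object. Instead, each vertex `x` carries `down x`,
-- its lobe towards a chosen root, and each lobe has a unique gate, its vertex nearest the root. The
-- obstacle in the extension is that the lobes at two corresponding vertices must be matched
-- consistently with the pair of lobes just crossed; giving that lobe number 0 within its type, on
-- both sides, achieves this. The resulting relation is symmetric in the two roots, so the inverse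
-- automorphism is the same construction with the roots exchanged.

-- Cardinalities up to ℵ₀ as numberings by natural numbers.

_<∞_ : ℕ → ℕ∪ℵ₀ → Set
k <∞ fin n = k < n
k <∞ ℵ₀    = ⊤

-- Indices are plain natural numbers in the finite and in the infinite case alike, so an index at
-- one vertex can be reused at another vertex with the same count.
record Numbering (A : Set) (_≈_ : Rel A 0ℓ) (c : ℕ∪ℵ₀) : Set where
  field
    index     : A → ℕ
    congruent : ∀ {a b} → a ≈ b → index a ≡ index b
    injective : ∀ {a b} → index a ≡ index b → a ≈ b
    bounded   : ∀ a → index a <∞ c
    covers    : ∀ {k} → k <∞ c → ∃[ a ] index a ≡ k

module _ {A : Set} {_≈_ : Rel A 0ℓ} where

  numbering : (∀ a → a ≈ a) → ∀ c → HasCardinality A _≈_ c → Numbering A _≈_ c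
  numbering ≈-refl (fin n) (f , cong-f , inj , surj) = record
    { index = toℕ ∘ f ; congruent = cong toℕ ∘ cong-f ; injective = inj ∘ toℕ-injective
    ; bounded = toℕ<n ∘ f
    ; covers = λ k<n → proj₁ (surj (fromℕ< k<n)) ,
        trans (cong toℕ (proj₂ (surj (fromℕ< k<n)) (≈-refl _))) (toℕ-fromℕ< k<n)
    }
  numbering ≈-refl ℵ₀ (f , cong-f , inj , surj) = record
    { index = f ; congruent = cong-f ; injective = inj ; bounded = λ _ → tt
    ; covers = λ {k} _ → proj₁ (surj k) , proj₂ (surj k) (≈-refl _) }

  hasCardinality : ∀ c → Numbering A _≈_ c → HasCardinality A _≈_ c
  hasCardinality (fin n) N = f , (λ a≈b → fromℕ<-cong′ (congruent a≈b)) ,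
      (λ eq → injective (fromℕ<-injective _ _ (bounded _) (bounded _) eq)) ,
      λ i → proj₁ (covers (toℕ<n i)) , λ z≈x →
        toℕ-injective (trans (toℕ-fromℕ< _) (trans (congruent z≈x) (proj₂ (covers (toℕ<n i)))))
    where
    open Numbering N
    f : A → Fin n
    f a = fromℕ< (bounded a)
    fromℕ<-cong′ : ∀ {a b} → index a ≡ index b → f a ≡ f b
    fromℕ<-cong′ eq = toℕ-injective (trans (toℕ-fromℕ< _) (trans eq (sym (toℕ-fromℕ< _))))
  hasCardinality ℵ₀ N = index , congruent , injective , λ k →
      proj₁ (covers tt) , λ z≈x → trans (congruent z≈x) (proj₂ (covers tt))
    where open Numbering N

  inhabited⇒positive : ∀ c → Numbering A _≈_ c → A → Positive c
  inhabited⇒positive (fin n) N a = ≤-trans (s≤s z≤n) (Numbering.bounded N a)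
  inhabited⇒positive ℵ₀      N a = tt

  positive⇒inhabited : ∀ c → Numbering A _≈_ c → Positive c → A
  positive⇒inhabited (fin n) N 0<n = proj₁ (Numbering.covers N 0<n)
  positive⇒inhabited ℵ₀      N _   = proj₁ (Numbering.covers N {0} tt)

module _ {A B : Set} {_≈ᴬ_ : Rel A 0ℓ} {_≈ᴮ_ : Rel B 0ℓ} where

  embed : ∀ {c n} (M : Numbering A _≈ᴬ_ c) → Numbering B _≈ᴮ_ (fin n) →
    (h : A → B) → (∀ {a b} → h a ≈ᴮ h b → a ≈ᴬ b) →
    Σ[ f ∈ (∀ k → k <∞ c → Fin n) ] (∀ {k l} p q → f k p ≡ f l q → k ≡ l)
  embed M N h inj =
    (λ k k<c → fromℕ< (Numbering.bounded N (h (proj₁ (Numbering.covers M k<c))))) ,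
    λ p q eq → trans (sym (proj₂ (Numbering.covers M p)))
      (trans (Numbering.congruent M (inj (Numbering.injective N (fromℕ<-injective _ _ _ _ eq))))
        (proj₂ (Numbering.covers M q)))

  card-≤ : ∀ {m n} → Numbering A _≈ᴬ_ (fin m) → Numbering B _≈ᴮ_ (fin n) →
    (h : A → B) → (∀ {a b} → h a ≈ᴮ h b → a ≈ᴬ b) → m ≤ n
  card-≤ M N h inj with f , f-inj ← embed M N h inj =
    injective⇒≤ {f = λ i → f (toℕ i) (toℕ<n i)} (λ eq → toℕ-injective (f-inj _ _ eq))

  ℵ₀≰fin : ∀ {n} → Numbering A _≈ᴬ_ ℵ₀ → Numbering B _≈ᴮ_ (fin n) →
    (h : A → B) → ¬ (∀ {a b} → h a ≈ᴮ h b → a ≈ᴬ b)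
  ℵ₀≰fin M N h inj with f , f-inj ← embed M N h inj =
    ℕ→Fin-notInjective (λ k → f k tt) (f-inj _ _)

-- Two finite values agree by the pigeonhole principle in both directions; a mixed pair would inject
-- ℕ into some `Fin n`.
card-≡ : ∀ {A B : Set} {_≈ᴬ_ : Rel A 0ℓ} {_≈ᴮ_ : Rel B 0ℓ} c d →
  Numbering A _≈ᴬ_ c → Numbering B _≈ᴮ_ d →
  (h : A → B) → (∀ {a b} → h a ≈ᴮ h b → a ≈ᴬ b) →
  (k : B → A) → (∀ {a b} → k a ≈ᴬ k b → a ≈ᴮ b) → c ≡ d
card-≡ (fin _) (fin _) M N h h-inj k k-inj = cong fin (≤-antisym (card-≤ M N h h-inj) (card-≤ N M k k-inj))
card-≡ (fin _) ℵ₀      M N h h-inj k k-inj = ⊥-elim (ℵ₀≰fin N M k k-inj)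
card-≡ ℵ₀      (fin _) M N h h-inj k k-inj = ⊥-elim (ℵ₀≰fin M N h h-inj)
card-≡ ℵ₀      ℵ₀      M N h h-inj k k-inj = refl

-- The transposition of 0 and `d`.
swap₀ : ℕ → ℕ → ℕ
swap₀ d k with k ≟ d | k ≟ 0
... | yes _ | _     = 0
... | no _  | yes _ = d
... | no _  | no _  = k

swap₀-self : ∀ d → swap₀ d d ≡ 0
swap₀-self d with d ≟ d
... | yes _  = refl
... | no d≢d = contradiction refl d≢d

swap₀-zero : ∀ d → swap₀ d 0 ≡ d
swap₀-zero d with 0 ≟ d
... | yes refl = refl
... | no _     = refl

swap₀-involutive : ∀ d k → swap₀ d (swap₀ d k) ≡ k
swap₀-involutive d k with k ≟ d | k ≟ 0
... | yes refl | _       = swap₀-zero d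
... | no _     | yes refl = swap₀-self d
... | no k≢d   | no k≢0 with k ≟ d | k ≟ 0
...   | yes k≡d | _       = contradiction k≡d k≢d
...   | no _    | yes k≡0 = contradiction k≡0 k≢0
...   | no _    | no _    = refl

swap₀-< : ∀ c {d k} → d <∞ c → k <∞ c → swap₀ d k <∞ c
swap₀-< ℵ₀              d<c k<c = tt
swap₀-< (fin n) {d} {k} d<n k<n with k ≟ d | k ≟ 0
... | yes _ | _     = ≤-trans (s≤s z≤n) k<n
... | no _  | yes _ = d<n
... | no _  | no _  = k<n

zero<∞ : ∀ c {k} → k <∞ c → 0 <∞ c
zero<∞ ℵ₀      _   = tt
zero<∞ (fin n) k<n = ≤-trans (s≤s z≤n) k<n

-- A pairing function: with s = a + b, the value lies between s² and s² + s, hence below (s + 1)²,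
-- so it determines s and then `a`.
pair : ℕ → ℕ → ℕ
pair a b = (a + b) * (a + b) + a

pair-< : ∀ a b a′ b′ → a + b < a′ + b′ → pair a b < pair a′ b′
pair-< a b a′ b′ s<s′ = begin-strict
  s * s + a       ≤⟨ +-monoʳ-≤ (s * s) (m≤m+n a b) ⟩
  s * s + s       ≡⟨ +-comm (s * s) s ⟩
  suc s * s       <⟨ *-monoʳ-< (suc s) (n<1+n s) ⟩
  suc s * suc s   ≤⟨ *-mono-≤ s<s′ s<s′ ⟩
  s′ * s′         ≤⟨ m≤m+n (s′ * s′) a′ ⟩
  s′ * s′ + a′    ∎
  where
  open ≤-Reasoning
  s s′ : ℕ
  s = a + b
  s′ = a′ + b′

pair-injective : ∀ a b a′ b′ → pair a b ≡ pair a′ b′ → a ≡ a′ × b ≡ b′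
pair-injective a b a′ b′ eq with <-cmp (a + b) (a′ + b′)
... | tri< lt _ _ = contradiction eq (<⇒≢ (pair-< a b a′ b′ lt))
... | tri> _ _ gt = contradiction (sym eq) (<⇒≢ (pair-< a′ b′ a b gt))
... | tri≈ _ s≡s′ _ = a≡a′ , +-cancelˡ-≡ a b b′ (trans s≡s′ (cong (_+ b′) (sym a≡a′)))
  where
  a≡a′ : a ≡ a′
  a≡a′ = +-cancelˡ-≡ ((a + b) * (a + b)) a a′
    (trans eq (cong (λ s → s * s + a′) (sym s≡s′)))

-- Least witnesses, and the cardinality of a set coded by natural numbers.

module Classical (em : ExcludedMiddle 0ℓ) where

  Least : (ℕ → Set) → ℕ → Set
  Least X k = X k × (∀ {j} → j < k → ¬ X j)

  least : {X : ℕ → Set} → ∃ X → ∃ (Least X)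
  least {X} (n , Xn) with search (suc n)
    where
    search : ∀ n → ∃ (Least X) ⊎ (∀ {j} → j < n → ¬ X j)
    search zero = inj₂ λ ()
    search (suc n) with search n
    ... | inj₁ found = inj₁ found
    ... | inj₂ none with em {X n}
    ...   | yes Xn = inj₁ (n , Xn , none)
    ...   | no ¬Xn = inj₂ λ j<1+n Xj → [ (λ j<n → none j<n Xj) , (λ { refl → ¬Xn Xj }) ]′ (m<1+n⇒m<n∨m≡n j<1+n)
  ... | inj₁ found = found
  ... | inj₂ none  = contradiction Xn (none (n<1+n n))

  least-unique : ∀ {X Y : ℕ → Set} {k l} → (∀ {j} → X j → Y j) → (∀ {j} → Y j → X j) →
    Least X k → Least Y l → k ≡ l
  least-unique {k = k} {l} X⊆Y Y⊆X (Xk , <k) (Yl , <l) with <-cmp k l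
  ... | tri< k<l _ _ = contradiction (X⊆Y Xk) (<l k<l)
  ... | tri≈ _ k≡l _ = k≡l
  ... | tri> _ _ l<k = contradiction (Y⊆X Yl) (<k l<k)

  module _ {A : Set} {_≈_ : Rel A 0ℓ} (code : A → ℕ)
    (code-cong : ∀ {a b} → a ≈ b → code a ≡ code b)
    (code-inj : ∀ {a b} → code a ≡ code b → a ≈ b) where

    private
      Code : ℕ → Set
      Code k = ∃[ a ] code a ≡ k

      -- The number of codes below the argument. At `code a` it is the position of `a` in the order
      -- of codes, so `count ∘ code` closes the gaps between codes.
      count : ℕ → ℕ
      count zero = zero
      count (suc k) with em {Code k}
      ... | yes _ = suc (count k)
      ... | no _  = count k

      count-suc : ∀ {k} → Code k → count (suc k) ≡ suc (count k)
      count-suc {k} Ck with em {Code k}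
      ... | yes _  = refl
      ... | no ¬Ck = contradiction Ck ¬Ck

      count-≤suc : ∀ k → count k ≤ count (suc k)
      count-≤suc k with em {Code k}
      ... | yes _ = n≤1+n _
      ... | no _  = ≤-refl

      count-mono : ∀ {k l} → k ≤ l → count k ≤ count l
      count-mono {k} {l} k≤l with m≤n⇒m<n∨m≡n k≤l
      count-mono {k} {suc l} _ | inj₁ (s≤s k≤l) = ≤-trans (count-mono k≤l) (count-≤suc l)
      ...                      | inj₂ refl      = ≤-refl

      count-strict : ∀ {k l} → Code k → k < l → count k < count l
      count-strict Ck k<l = subst (_≤ _) (count-suc Ck) (count-mono k<l)

      -- `count` rises by exactly one at each code and nowhere else, so it passes every value below
      -- `count N` at some code.
      find : ∀ N {m} → m < count N → ∃[ a ] count (code a) ≡ m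
      find (suc N) m<c with em {Code N}
      ... | no _ = find N m<c
      ... | yes (a , eq) = [ find N , (λ m≡c → a , trans (cong count eq) (sym m≡c)) ]′ (m<1+n⇒m<n∨m≡n m<c)

      number : ∀ c → (∀ a → count (code a) <∞ c) → (∀ {k} → k <∞ c → ∃[ a ] count (code a) ≡ k) →
        Numbering A _≈_ c
      number c bounded covers = record
        { index = count ∘ code ; congruent = cong count ∘ code-cong ; injective = inj
        ; bounded = bounded ; covers = covers }
        where
        inj : ∀ {a b} → count (code a) ≡ count (code b) → a ≈ b
        inj {a} {b} eq with <-cmp (code a) (code b)
        ... | tri< lt _ _ = contradiction eq (<⇒≢ (count-strict (a , refl) lt))
        ... | tri≈ _ eq′ _ = code-inj eq′
        ... | tri> _ _ gt = contradiction (sym eq) (<⇒≢ (count-strict (b , refl) gt))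

    -- If codes are bounded by `N`, positions fill the numbers below `count N`. Otherwise there is a
    -- further code beyond every `N`, so `count` exceeds every `k` and all positions occur.
    countable : ∃[ c ] Numbering A _≈_ c
    countable with em {∃[ N ] (∀ a → code a < N)}
    ... | yes (N , <N) = fin (count N) , number _ (λ a → count-strict (a , refl) (<N a)) (find N)
    ... | no unbounded = ℵ₀ , number ℵ₀ (λ _ → tt) (λ {k} _ → find (proj₁ (large k)) (proj₂ (large k)))
      where
      beyond : ∀ N → ∃[ a ] N ≤ code a
      beyond N with em {∃[ a ] N ≤ code a}
      ... | yes found = found
      ... | no none   = contradiction (N , λ a → ≰⇒> λ N≤a → none (a , N≤a)) unbounded
      large : ∀ k → ∃[ N ] k < count N
      large zero with a , _ ← beyond 0 =
        suc (code a) , subst (0 <_) (sym (count-suc (a , refl))) (s≤s z≤n)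
      large (suc k) with N , k<c ← large k with a , N≤a ← beyond N =
        suc (code a) , subst (suc k <_) (sym (count-suc (a , refl))) (s≤s (≤-trans k<c (count-mono N≤a)))

-- Walks, paths and cycles.

module LobeTheory (em : ExcludedMiddle 0ℓ) (Γ : Graph) where
  open Graph Γ
  open Edge

  -- The constraint `X` on the vertices is part of the type, so that avoiding a vertex and being
  -- disjoint become statements about predicates.
  data Walk (X : Pred V 0ℓ) : V → V → Set where
    here : ∀ {a} → X a → Walk X a a
    step : ∀ {a b c} → X a → a ~ b → Walk X b c → Walk X a c

  module _ {X : Pred V 0ℓ} where

    start : ∀ {a b} → Walk X a b → X a
    start (here x)     = x
    start (step x _ _) = x

    end : ∀ {a b} → Walk X a b → X b
    end (here x)     = x
    end (step _ _ w) = end w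

    join : ∀ {a b c} → Walk X a b → Walk X b c → Walk X a c
    join (here _)      w′ = w′
    join (step x e w) w′ = step x e (join w w′)

    reverse : ∀ {a b} → Walk X a b → Walk X b a
    reverse (here x)     = here x
    reverse (step x e w) = join (reverse w) (step (start w) (~-sym e) (here x))

    On : ∀ {a b} → Walk X a b → Pred V 0ℓ
    On (here {a} _)     v = v ≡ a
    On (step {a} _ _ w) v = v ≡ a ⊎ On w v

  widen : ∀ {X Y : Pred V 0ℓ} {a b} → X ⊆ Y → Walk X a b → Walk Y a b
  widen X⊆Y (here x)     = here (X⊆Y x)
  widen X⊆Y (step x e w) = step (X⊆Y x) e (widen X⊆Y w)

  module _ {X : Pred V 0ℓ} where

    On⊆ : ∀ {a b} (w : Walk X a b) → On w ⊆ X
    On⊆ (here x)     refl        = x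
    On⊆ (step x e w) (inj₁ refl) = x
    On⊆ (step x e w) (inj₂ v∈w)  = On⊆ w v∈w

    onStart : ∀ {a b} (w : Walk X a b) → On w a
    onStart (here _)     = refl
    onStart (step _ _ _) = inj₁ refl

    suffix : ∀ {a b z} (w : Walk X a b) → On w z → Walk (On w) z b
    suffix (here x)     refl        = here refl
    suffix (step x e w) (inj₁ refl) = step (inj₁ refl) e (widen inj₂ (suffix w (onStart w)))
    suffix (step x e w) (inj₂ z∈w)  = widen inj₂ (suffix w z∈w)

    restrict : ∀ {a b} (w : Walk X a b) → Walk (On w) a b
    restrict w = suffix w (onStart w)

    firstVisit : (T : Pred V 0ℓ) → ∀ {a b} → Walk X a b → T b →
      ∃[ z ] T z × X z × Walk (λ t → t ≡ z ⊎ (X ∖ T) t) a z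
    firstVisit T (here x) Tb = _ , Tb , x , here (inj₁ refl)
    firstVisit T (step {a} x e w) Tb with em {T a}
    ... | yes Ta = a , Ta , x , here (inj₁ refl)
    ... | no ¬Ta with z , Tz , Xz , w′ ← firstVisit T w Tb =
      z , Tz , Xz , step (inj₂ (x , ¬Ta)) e w′

    LastVisit : Pred V 0ℓ → V → V → Set
    LastVisit T z c = z ≡ c ⊎ (∃[ b ] z ~ b × Walk (X ∖ T) b c)

    lastVisit : (T : Pred V 0ℓ) → ∀ {a c} → Walk X a c →
      Walk (X ∖ T) a c ⊎ (∃[ z ] T z × X z × LastVisit T z c)
    lastVisit T (here {a} x) with em {T a}
    ... | yes Ta = inj₂ (a , Ta , x , inj₁ refl)
    ... | no ¬Ta = inj₁ (here (x , ¬Ta))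
    lastVisit T (step {a} x e w) with lastVisit T w
    ... | inj₂ l = inj₂ l
    ... | inj₁ w′ with em {T a}
    ...   | yes Ta = inj₂ (a , Ta , x , inj₂ (_ , e , w′))
    ...   | no ¬Ta = inj₁ (step (x , ¬Ta) e w′)

    lastExit : ∀ {a c} → Walk X a c → LastVisit (_≡ a) a c
    lastExit {a} w with lastVisit (_≡ a) w
    ... | inj₁ w′                  = contradiction refl (proj₂ (start w′))
    ... | inj₂ (_ , refl , _ , l) = l

  data Path : V → V → List V → Set where
    here : ∀ {a} → Path a a (a ∷ [])
    step : ∀ {a b c l} → a ~ b → Path b c l → Path a c (a ∷ l)

  pathSuffix : ∀ {X : Pred V 0ℓ} {b c l a} → Path b c l → Unique l → All X l → a ∈ˡ l →
    ∃[ l′ ] Path a c l′ × Unique l′ × All X l′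
  pathSuffix here           u        x       (here refl) = _ , here , u , x
  pathSuffix p@(step _ _)   u        x       (here refl) = _ , p , u , x
  pathSuffix (step _ p)     (_ ∷ u)  (_ ∷ x) (there a∈l) = pathSuffix p u x a∈l

  -- Loop erasure: if the new first vertex already occurs on the path, everything before that
  -- occurrence is dropped.
  toPath : ∀ {X : Pred V 0ℓ} {a c} → Walk X a c → ∃[ l ] Path a c l × Unique l × All X l
  toPath (here x) = _ , here , ([] ∷ []) , (x ∷ [])
  toPath (step {a} x e w) with toPath w
  ... | l , p , u , xs with em {a ∈ˡ l}
  ...   | yes a∈l = pathSuffix p u xs a∈l
  ...   | no a∉l  = a ∷ l , step e p , (Allₚ.¬Any⇒All¬ l a∉l ∷ u) , (x ∷ xs)

  pathClose : ∀ {a b l x} → Path a b l → b ~ x → Linked _~_ (l ∷ʳ x)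
  pathClose here                   b~x = b~x ∷ [-]
  pathClose (step e here)          b~x = e ∷ b~x ∷ [-]
  pathClose (step e p@(step _ _)) b~x = e ∷ pathClose p b~x

  pathJoin : ∀ {a b c d l m} → Path a c l → c ~ d → Path d b m → Path a b (l ++ m)
  pathJoin here       c~d q = step c~d q
  pathJoin (step e p) c~d q = step e (pathJoin p c~d q)

  pathLast : ∀ {a b l} → Path a b l → ∃[ l′ ] l ≡ l′ ++ b ∷ []
  pathLast here = [] , refl
  pathLast (step {a} _ p) with l′ , refl ← pathLast p = a ∷ l′ , refl

  pathHead : ∀ {a b l} → Path a b l → ∃[ l′ ] l ≡ a ∷ l′
  pathHead here       = _ , refl
  pathHead (step _ _) = _ , refl

  -- A common cycle of the edges ab and cd is the same as a pair of disjoint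
  -- paths joining their ends; this avoids rotating and reversing cycles.
  record Ladder (a b c d : V) : Set₁ where
    field
      X Y      : Pred V 0ℓ
      disjoint : ∀ {v} → X v → ¬ Y v
      left     : Walk X a c
      right    : Walk Y b d

  ladderSwap : ∀ {a b c d} → Ladder a b c d → Ladder b a d c
  ladderSwap L = record
    { X = Y ; Y = X ; disjoint = λ y x → disjoint x y ; left = right ; right = left }
    where open Ladder L

  flip : Edge Γ → Edge Γ
  flip (edge u v e) = edge v u (~-sym e)

  -- The cycle runs along the left side to `c`, crosses to `d`, returns along the right side to `b`
  -- and closes with the edge `ba`. It is too short only if both sides are single vertices, and then
  -- the edges coincide.
  ladder⇒≅ : (e f : Edge Γ) → Ladder (end₁ e) (end₂ e) (end₁ f) (end₂ f) → e ≅ f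
  ladder⇒≅ (edge a b a~b) (edge c d c~d) L
    with toPath (Ladder.left L) | toPath (reverse (Ladder.right L))
  ... | l , p , up , xs | m , q , uq , ys with pathHead p | pathHead q | em {a ≡ c × d ≡ b}
  ... | _ | _ | yes (a≡c , d≡b) = inj₁ (inj₁ (a≡c , sym d≡b))
  ... | l₁ , refl | m₁ , refl | no ¬same = inj₂ (a , l₁ ++ d ∷ m₁ , cycle , onE , onF)
    where
    open Ladder L
    r : Path a b (a ∷ l₁ ++ d ∷ m₁)
    r = pathJoin p c~d q
    atLeast2 : ∀ l₁ m₁ → Path a c (a ∷ l₁) → Path d b (d ∷ m₁) → 2 ≤ length (l₁ ++ d ∷ m₁)
    atLeast2 []          []      here here = contradiction (refl , refl) ¬same
    atLeast2 []          (_ ∷ _) _    _    = s≤s (s≤s z≤n)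
    atLeast2 (_ ∷ [])    _       _    _    = s≤s (s≤s z≤n)
    atLeast2 (_ ∷ _ ∷ _) _       _    _    = s≤s (s≤s z≤n)
    cycle : IsCycle a (l₁ ++ d ∷ m₁)
    cycle = record
      { closedWalk = pathClose r (~-sym a~b)
      ; distinct   = Uniqueₚ.++⁺ up uq
          λ { (v∈l , v∈m) → disjoint (All.lookup xs v∈l) (All.lookup ys v∈m) }
      ; long       = atLeast2 l₁ m₁ p q
      }
    onE : LiesOn {Γ} (edge a b a~b) (a ∷ (l₁ ++ d ∷ m₁) ∷ʳ a)
    onE with ps , eq ← pathLast r =
      inj₂ (ps , [] , trans (cong (_∷ʳ a) eq) (++-assoc ps (b ∷ []) (a ∷ [])))
    onF : LiesOn {Γ} (edge c d c~d) (a ∷ (l₁ ++ d ∷ m₁) ∷ʳ a)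
    onF with ps , eq ← pathLast p = inj₁ (ps , m₁ ∷ʳ a , (begin
      (a ∷ l₁ ++ d ∷ m₁) ∷ʳ a             ≡⟨ ++-assoc (a ∷ l₁) (d ∷ m₁) (a ∷ []) ⟩
      (a ∷ l₁) ++ d ∷ m₁ ∷ʳ a             ≡⟨ cong (_++ d ∷ m₁ ∷ʳ a) eq ⟩
      (ps ++ c ∷ []) ++ d ∷ m₁ ∷ʳ a       ≡⟨ ++-assoc ps (c ∷ []) _ ⟩
      ps ++ c ∷ d ∷ m₁ ∷ʳ a               ∎))
      where open ≡-Reasoning

  ≅-sym : (e f : Edge Γ) → e ≅ f → f ≅ e
  ≅-sym _ _ (inj₁ (inj₁ (p , q)))                = inj₁ (inj₁ (sym p , sym q))
  ≅-sym _ _ (inj₁ (inj₂ (p , q)))                = inj₁ (inj₂ (sym q , sym p))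
  ≅-sym _ _ (inj₂ (x , xs , cycle , onE , onF)) = inj₂ (x , xs , cycle , onF , onE)

  ≅-refl : (e : Edge Γ) → e ≅ e
  ≅-refl _ = inj₁ (inj₁ (refl , refl))

  -- Edges on a common cycle versus edges that no vertex separates.

  EndOf : Edge Γ → Pred V 0ℓ
  EndOf e v = v ≡ end₁ e ⊎ v ≡ end₂ e

  SameSide : V → Edge Γ → Edge Γ → Set
  SameSide v e f = ∀ s t → EndOf e s → EndOf f t → s ≢ v → t ≢ v → Walk (_≢ v) s t

  -- Composing two common cycles needs rerouting, whereas this relation is transitive by joining
  -- walks: the middle edge always has an end different from `v`.
  Inseparable : Edge Γ → Edge Γ → Set
  Inseparable e f = ∀ v → SameSide v e f

  otherEnd : (e : Edge Γ) (v : V) → ∃[ s ] EndOf e s × s ≢ v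
  otherEnd (edge a b a~b) v with em {a ≡ v}
  ... | no a≢v   = a , inj₁ refl , a≢v
  ... | yes refl = b , inj₂ refl , λ { refl → ~-irrefl a~b }

  inseparable-trans : ∀ e f g → Inseparable e f → Inseparable f g → Inseparable e g
  inseparable-trans _ f _ i j v s t s∈e t∈g s≢v t≢v with m , m∈f , m≢v ← otherEnd f v =
    join (i v s m s∈e m∈f s≢v m≢v) (j v m t m∈f t∈g m≢v t≢v)

  prefixWalk : ∀ {X : Pred V 0ℓ} {h l s} → Linked _~_ (h ∷ l) → All X (h ∷ l) → s ∈ˡ h ∷ l → Walk X h s
  prefixWalk _       (x ∷ _)           (here refl) = here x
  prefixWalk (e ∷ k) (x ∷ xs@(_ ∷ _)) (there s∈l) = step x e (prefixWalk k xs s∈l)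

  linked-++ˡ : ∀ xs {ys} → Linked _~_ (xs ++ ys) → Linked _~_ xs
  linked-++ˡ []           _       = []
  linked-++ˡ (_ ∷ [])     _       = [-]
  linked-++ˡ (_ ∷ y ∷ xs) (e ∷ k) = e ∷ linked-++ˡ (y ∷ xs) k

  linked-++ʳ : ∀ xs {ys} → Linked _~_ (xs ++ ys) → Linked _~_ ys
  linked-++ʳ []       k = k
  linked-++ʳ (_ ∷ xs) k = linked-++ʳ xs (Linked.tail k)

  unique-++ : ∀ {v : V} xs {ys} → Unique (xs ++ ys) → v ∈ˡ xs → ¬ (v ∈ˡ ys)
  unique-++ (_ ∷ xs) (x∉ ∷ _) (here refl) v∈ys = All.lookup x∉ (∈-++⁺ʳ xs v∈ys) refl
  unique-++ (_ ∷ xs) (_ ∷ u)  (there v∈xs) v∈ys = unique-++ xs u v∈xs v∈ys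

  ∉⇒All≢ : ∀ {v : V} {l} → ¬ (v ∈ˡ l) → All (_≢ v) l
  ∉⇒All≢ v∉l = All.tabulate λ { v∈l refl → v∉l v∈l }

  module _ {x : V} {xs : List V} (C : IsCycle {Γ} x xs) where
    open IsCycle C

    -- The vertex `s` cuts the cycle into two arcs that end at `x`. As the cycle repeats no vertex,
    -- `v` lies on at most one of them, and the other serves as the walk.
    cycle-base : ∀ {v s} → x ≢ v → s ≢ v → s ∈ˡ x ∷ xs → Walk (_≢ v) x s
    cycle-base x≢v s≢v (here refl) = here x≢v
    cycle-base {v} {s} x≢v s≢v (there s∈xs) with as , bs , refl ← ∈-∃++ s∈xs | em {v ∈ˡ as}
    ... | no v∉as = prefixWalk (linked-++ˡ (x ∷ as ++ s ∷ []) linked)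
          (x≢v ∷ Allₚ.++⁺ (∉⇒All≢ v∉as) (s≢v ∷ [])) (there (∈-++⁺ʳ as (here refl)))
      where
      linked : Linked _~_ ((x ∷ as ++ s ∷ []) ++ bs ++ x ∷ [])
      linked = subst (Linked _~_) (trans (++-assoc (x ∷ as) (s ∷ bs) (x ∷ []))
                 (sym (++-assoc (x ∷ as) (s ∷ []) (bs ++ x ∷ [])))) closedWalk
    ... | yes v∈as = reverse (prefixWalk (linked-++ʳ (x ∷ as) linked)
          (s≢v ∷ Allₚ.++⁺ (∉⇒All≢ v∉bs) (x≢v ∷ [])) (there (∈-++⁺ʳ bs (here refl))))
      where
      v∉bs : ¬ (v ∈ˡ bs)
      v∉bs v∈bs with _ ∷ u ← distinct = unique-++ as u v∈as (there v∈bs)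
      linked : Linked _~_ ((x ∷ as) ++ s ∷ bs ++ x ∷ [])
      linked = subst (Linked _~_) (++-assoc (x ∷ as) (s ∷ bs) (x ∷ [])) closedWalk

    -- The case where the base point itself is removed: what remains is the linear path `xs`.
    cycle-inner : ∀ {s t} → s ∈ˡ xs → t ∈ˡ xs → Walk (_≢ x) s t
    cycle-inner {s} {t} = go xs (linked-++ˡ xs (Linked.tail closedWalk)) x∉xs
      where
      x∉xs : All (_≢ x) xs
      x∉xs with k ∷ _ ← distinct = All.map ≢-sym k
      go : ∀ l → Linked _~_ l → All (_≢ x) l → s ∈ˡ l → t ∈ˡ l → Walk (_≢ x) s t
      go (_ ∷ _) k n s∈l t∈l = join (reverse (prefixWalk k n s∈l)) (prefixWalk k n t∈l)

    cycle-connected : ∀ {v s t} → s ∈ˡ x ∷ xs → t ∈ˡ x ∷ xs → s ≢ v → t ≢ v → Walk (_≢ v) s t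
    cycle-connected {v} s∈C t∈C s≢v t≢v with em {x ≡ v} | s∈C | t∈C
    ... | no x≢v   | _          | _          = join (reverse (cycle-base x≢v s≢v s∈C)) (cycle-base x≢v t≢v t∈C)
    ... | yes refl | here refl  | _          = contradiction refl s≢v
    ... | yes refl | there _    | here refl  = contradiction refl t≢v
    ... | yes refl | there s∈xs | there t∈xs = cycle-inner s∈xs t∈xs

    ∈-closed : ∀ {s} → s ∈ˡ x ∷ xs ∷ʳ x → s ∈ˡ x ∷ xs
    ∈-closed s∈C with ∈-++⁻ (x ∷ xs) s∈C
    ... | inj₁ s∈xs         = s∈xs
    ... | inj₂ (here refl) = here refl

  liesOn⇒∈ : ∀ {e : Edge Γ} {ws s} → LiesOn e ws → EndOf e s → s ∈ˡ ws
  liesOn⇒∈ (inj₁ (ps , _ , refl)) (inj₁ refl) = ∈-++⁺ʳ ps (here refl)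
  liesOn⇒∈ (inj₁ (ps , _ , refl)) (inj₂ refl) = ∈-++⁺ʳ ps (there (here refl))
  liesOn⇒∈ (inj₂ (ps , _ , refl)) (inj₁ refl) = ∈-++⁺ʳ ps (there (here refl))
  liesOn⇒∈ (inj₂ (ps , _ , refl)) (inj₂ refl) = ∈-++⁺ʳ ps (here refl)

  endOf-same : ∀ (e f : Edge Γ) → SameEdge e f → EndOf e ⊆ EndOf f
  endOf-same _ _ (inj₁ (refl , refl)) = id
  endOf-same _ _ (inj₂ (refl , refl)) = [ inj₂ , inj₁ ]′

  inseparable-refl : ∀ e → Inseparable e e
  inseparable-refl e v s t (inj₁ refl) (inj₁ refl) s≢v _   = here s≢v
  inseparable-refl e v s t (inj₁ refl) (inj₂ refl) s≢v t≢v = step s≢v (adjacent e) (here t≢v)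
  inseparable-refl e v s t (inj₂ refl) (inj₁ refl) s≢v t≢v = step s≢v (~-sym (adjacent e)) (here t≢v)
  inseparable-refl e v s t (inj₂ refl) (inj₂ refl) s≢v _   = here s≢v

  ≅⇒inseparable : ∀ (e f : Edge Γ) → e ≅ f → Inseparable e f
  ≅⇒inseparable e f (inj₁ same) v s t s∈e t∈f =
    inseparable-refl f v s t (endOf-same e f same s∈e) t∈f
  ≅⇒inseparable e f (inj₂ (_ , _ , C , onE , onF)) v s t s∈e t∈f =
    cycle-connected C (∈-closed C (liesOn⇒∈ {e} onE s∈e)) (∈-closed C (liesOn⇒∈ {f} onF t∈f))

  -- For two edges with the common end `x`, one side of the ladder shrinks to the vertex `x`.
  cherryLadder : ∀ {x y z} → Walk (_≢ x) y z → Ladder x y x z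
  cherryLadder {x} w = record
    { X = _≡ x ; Y = _≢ x ; disjoint = λ v≡x v≢x → v≢x v≡x ; left = here refl ; right = w }

  _LadderTo_ : V × V → Edge Γ → Set₁
  (u , v) LadderTo f = Ladder u v (end₁ f) (end₂ f) ⊎ Ladder u v (end₂ f) (end₁ f)

  -- Follow the walk from u until it first meets the ladder; the side it meets is
  -- rerouted to start at u, and the other side to start at v.
  ladderExtend : ∀ {u v w c d} → v ~ w → Walk (_≢ v) u w → Ladder v w c d →
    Ladder u v c d ⊎ Ladder v u c d
  ladderExtend {u} {v} {w} {c} {d} v~w u⇝w L with lastExit left
    where open Ladder L
  -- Here `c` is `v`, so both edges end at `v`; the walk to `w` followed by the right side avoids
  -- `v`, which lies on the left side.
  ... | inj₁ refl = inj₂ (cherryLadder (join u⇝w (widen (λ { Yt refl → disjoint (start left) Yt }) right)))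
    where open Ladder L
  ... | inj₂ (b , v~b , b⇝c) = hit (firstVisit T u⇝w (inj₂ (onStart right)))
    where
    open Ladder L
    A B T : Pred V 0ℓ
    A t = t ≡ v ⊎ On b⇝c t
    B t = t ≡ v ⊎ On right t
    T t = On b⇝c t ⊎ On right t
    v⇝c : Walk A v c
    v⇝c = step (inj₁ refl) v~b (widen inj₂ (restrict b⇝c))
    v⇝d : Walk B v d
    v⇝d = step (inj₁ refl) v~w (widen inj₂ (restrict right))
    hit : (∃[ z ] T z × z ≢ v × Walk (λ t → t ≡ z ⊎ ((_≢ v) ∖ T) t) u z) →
      Ladder u v c d ⊎ Ladder v u c d
    hit (z , inj₁ z∈left , z≢v , u⇝z) = inj₁ (record
      { X = λ t → ¬ B t ; Y = B ; disjoint = id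
      ; left = join
          (widen (λ { (inj₁ refl) → ¬B z∈left ; (inj₂ (t≢v , t∉T)) → [ t≢v , t∉T ∘ inj₂ ]′ }) u⇝z)
          (widen ¬B (suffix b⇝c z∈left))
      ; right = v⇝d })
      where
      ¬B : ∀ {t} → On b⇝c t → ¬ B t
      ¬B t∈ (inj₁ refl) = proj₂ (On⊆ b⇝c t∈) refl
      ¬B t∈ (inj₂ t∈r)  = disjoint (proj₁ (On⊆ b⇝c t∈)) (On⊆ right t∈r)
    hit (z , inj₂ z∈right , z≢v , u⇝z) = inj₂ (record
      { X = A ; Y = λ t → ¬ A t ; disjoint = λ a na → na a
      ; left = v⇝c
      ; right = join
          (widen (λ { (inj₁ refl) → ¬A z∈right ; (inj₂ (t≢v , t∉T)) → [ t≢v , t∉T ∘ inj₁ ]′ }) u⇝z)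
          (widen ¬A (suffix right z∈right)) })
      where
      ¬A : ∀ {t} → On right t → ¬ A t
      ¬A t∈ (inj₁ refl) = disjoint (start left) (On⊆ right t∈)
      ¬A t∈ (inj₂ t∈l)  = disjoint (proj₁ (On⊆ b⇝c t∈l)) (On⊆ right t∈)

  ladderTo⇒≅ : ∀ e f → (end₁ e , end₂ e) LadderTo f → e ≅ f
  ladderTo⇒≅ e f (inj₁ L) = ladder⇒≅ e f L
  ladderTo⇒≅ e f (inj₂ L) with ladder⇒≅ e (flip f) L
  ... | inj₁ (inj₁ (p , q)) = inj₁ (inj₂ (p , q))
  ... | inj₁ (inj₂ (p , q)) = inj₁ (inj₁ (p , q))
  ... | inj₂ (x , xs , C , onE , onF) = inj₂ (x , xs , C , onE , [ inj₂ , inj₁ ]′ onF)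

  star⇒walk : ∀ {a b} → Star _~_ a b → Walk U a b
  star⇒walk ε       = here _
  star⇒walk (e ◅ w) = step _ e (star⇒walk w)

  cherry : ∀ {x y z} (x~y : x ~ y) (x~z : x ~ z) → Walk (_≢ x) y z → edge x y x~y ≅ edge x z x~z
  cherry x~y x~z w = ladder⇒≅ (edge _ _ x~y) (edge _ _ x~z) (cherryLadder w)

  pathWalk : ∀ {X a b l} → Path a b l → All X l → Walk X a b
  pathWalk here       (x ∷ _)  = here x
  pathWalk (step e p) (x ∷ xs) = step x e (pathWalk p xs)

  ~⇒≢ : ∀ {u v} → u ~ v → u ≢ v
  ~⇒≢ u~v refl = ~-irrefl u~v

  -- Induction along a path from v to f: as v does not separate uv from f, the edge
  -- uv lies on a cycle with the next edge vw of the path, so vw is inseparable from f.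
  inseparable⇒ladderTo : ∀ f {u v l} (u~v : u ~ v) → Path v (end₁ f) l → Unique l →
    Inseparable (edge u v u~v) f → (u , v) LadderTo f
  inseparable⇒ladderTo f {u} {v} u~v here _ i =
    inj₂ (ladderSwap (cherryLadder
      (i v u (end₂ f) (inj₁ refl) (inj₂ refl) (~⇒≢ u~v) (≢-sym (~⇒≢ (adjacent f))))))
  inseparable⇒ladderTo f {u} {v} u~v (step {b = w} v~w p) (v∉p ∷ up) i = extend
    where
    w⇝f : Walk (_≢ v) w (end₁ f)
    w⇝f = pathWalk p (All.map ≢-sym v∉p)
    u⇝w : Walk (_≢ v) u w
    u⇝w = join (i v u (end₁ f) (inj₁ refl) (inj₁ refl) (~⇒≢ u~v) (end w⇝f)) (reverse w⇝f)
    next : (v , w) LadderTo f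
    next = inseparable⇒ladderTo f v~w p up
      (inseparable-trans vw vu f (≅⇒inseparable vw vu (cherry v~w (~-sym u~v) (reverse u⇝w)))
        (inseparable-trans vu (edge u v u~v) f
          (≅⇒inseparable vu (edge u v u~v) (inj₁ (inj₂ (refl , refl)))) i))
      where
      vw vu : Edge Γ
      vw = edge v w v~w
      vu = edge v u (~-sym u~v)
    reorient : ∀ {c d} → Ladder u v c d ⊎ Ladder v u c d → Ladder u v c d ⊎ Ladder u v d c
    reorient = [ inj₁ , inj₂ ∘ ladderSwap ]′
    extend : (u , v) LadderTo f
    extend with next
    ... | inj₁ L = reorient (ladderExtend v~w u⇝w L)
    ... | inj₂ L with reorient (ladderExtend v~w u⇝w L)
    ...   | inj₁ M = inj₂ M
    ...   | inj₂ M = inj₁ M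

  -- Lobes, and their arrangement around a root.

  module Lobes (connected : Connected Γ) where

    inseparable⇒≅ : ∀ e f → Inseparable e f → e ≅ f
    inseparable⇒≅ e f i with _ , p , u , _ ← toPath (star⇒walk (connected (end₂ e) (end₁ f))) =
      ladderTo⇒≅ e f (inseparable⇒ladderTo f (adjacent e) p u i)

    ≅-trans : (e f g : Edge Γ) → e ≅ f → f ≅ g → e ≅ g
    ≅-trans e f g p q =
      inseparable⇒≅ e g (inseparable-trans e f g (≅⇒inseparable e f p) (≅⇒inseparable f g q))

    vlobe-cong : ∀ Λ Λ′ → Λ ≅ Λ′ → VLobe Λ ⊆ VLobe Λ′
    vlobe-cong Λ Λ′ p (e , e∈Λ , v∈e) = e , ≅-trans e Λ Λ′ e∈Λ p , v∈e

    end∈lobe : ∀ (Λ : Lobe Γ) {x y} (x~y : x ~ y) → edge x y x~y ≅ Λ → VLobe Λ x × VLobe Λ y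
    end∈lobe Λ {x} {y} x~y p = (edge x y x~y , p , inj₁ refl) , (edge x y x~y , p , inj₂ refl)

    edgeAt : ∀ (Λ : Lobe Γ) {x} → VLobe Λ x → ∃[ y ] Σ[ x~y ∈ x ~ y ] edge x y x~y ≅ Λ
    edgeAt Λ (edge x y x~y , e≅Λ , inj₁ refl) = y , x~y , e≅Λ
    edgeAt Λ (edge y x y~x , e≅Λ , inj₂ refl) =
      y , ~-sym y~x , ≅-trans (edge x y (~-sym y~x)) (edge y x y~x) Λ (inj₁ (inj₂ (refl , refl))) e≅Λ

    module Rooted (r : V) (Λ : Lobe Γ) (r∈Λ : VLobe Λ r) where

      exit : ∀ {x} → x ≢ r → ∃[ y ] x ~ y × Walk (_≢ x) y r
      exit {x} x≢r with lastExit (star⇒walk (connected x r))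
      ... | inj₁ x≡r           = contradiction x≡r x≢r
      ... | inj₂ (y , x~y , w) = y , x~y , widen proj₂ w

      abstract
        -- The lobe at x through which every path from x to r leaves; at the root
        -- itself this is Λ by convention.
        down : V → Lobe Γ
        down x with em {x ≡ r}
        ... | yes _  = Λ
        ... | no x≢r = edge x (proj₁ (exit x≢r)) (proj₁ (proj₂ (exit x≢r)))

        down-root : down r ≡ Λ
        down-root with em {r ≡ r}
        ... | yes _  = refl
        ... | no r≢r = contradiction refl r≢r

        down-exit : ∀ {x} → x ≢ r → ∃[ y ] Σ[ x~y ∈ x ~ y ] down x ≡ edge x y x~y × Walk (_≢ x) y r
        down-exit {x} x≢r with em {x ≡ r}
        ... | yes x≡r = contradiction x≡r x≢r
        ... | no x≢r′ = _ , _ , refl , proj₂ (proj₂ (exit x≢r′))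

        ∈down : ∀ x → VLobe (down x) x
        ∈down x with em {x ≡ r}
        ... | yes refl = r∈Λ
        ... | no x≢r  = let Θ : Edge Γ ; Θ = edge x _ (proj₁ (proj₂ (exit x≢r)))
                         in Θ , ≅-refl Θ , inj₁ refl

      -- The choice of exit is immaterial: two neighbours of `x` that both reach `r` without `x` are
      -- joined without `x`, so their edges to `x` lie on a common cycle or coincide.
      walk⇒down : ∀ {x y} → x ≢ r → (x~y : x ~ y) → Walk (_≢ x) y r → edge x y x~y ≅ down x
      walk⇒down {x} {y} x≢r x~y w with down-exit x≢r
      ... | _ , x~z , eq , w′ = subst (edge x y x~y ≅_) (sym eq) (cherry x~y x~z (join w (reverse w′)))

      -- The vertex through which the lobe Θ is entered from r.
      Gate : Lobe Γ → V → Set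
      Gate Θ g = VLobe Θ g × (g ≡ r ⊎ ¬ (Θ ≅ down g))

      gate-cong : ∀ Θ Θ′ {g} → Θ ≅ Θ′ → Gate Θ g → Gate Θ′ g
      gate-cong Θ Θ′ p (g∈Θ , inj₁ g≡r) = vlobe-cong Θ Θ′ p g∈Θ , inj₁ g≡r
      gate-cong Θ Θ′ {g} p (g∈Θ , inj₂ Θ≇) =
        vlobe-cong Θ Θ′ p g∈Θ , inj₂ λ q → Θ≇ (≅-trans Θ Θ′ (down g) p q)

      -- The gate is the last vertex of `Θ` on a walk to `r`. If it is not `r`, the edge by which
      -- the walk leaves it belongs to `down g`; were this `Θ`, the next vertex would still be in
      -- `Θ`.
      gate-exists : ∀ Θ → ∃ (Gate Θ)
      gate-exists Θ with lastVisit (VLobe Θ) (star⇒walk (connected (end₁ Θ) r))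
      ... | inj₁ w                           = contradiction (Θ , ≅-refl Θ , inj₁ refl) (proj₂ (start w))
      ... | inj₂ (g , g∈Θ , _ , inj₁ g≡r)   = g , g∈Θ , inj₁ g≡r
      ... | inj₂ (g , g∈Θ , _ , inj₂ (h , g~h , w)) with em {g ≡ r}
      ...   | yes g≡r = g , g∈Θ , inj₁ g≡r
      ...   | no g≢r  = g , g∈Θ , inj₂ λ Θ≅ → proj₂ (start w)
        (proj₂ (end∈lobe Θ g~h (≅-trans (edge g h g~h) (down g) Θ
          (walk⇒down g≢r g~h (widen (λ { (_ , t∉Θ) refl → t∉Θ g∈Θ }) w)) (≅-sym Θ (down g) Θ≅))))

      -- Removing `g` leaves the rest of `Θ` connected. If one of its vertices reached `r` without
      -- `g`, so would a neighbour of `g` in `Θ`, making `Θ` the lobe `down g`.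
      gate-separates : ∀ Θ {g s} → Gate Θ g → VLobe Θ s → s ≢ g → ¬ Walk (_≢ g) s r
      gate-separates Θ (_ , inj₁ refl) _ _ w = end w refl
      gate-separates Θ {g} {s} (g∈Θ , inj₂ Θ≇) (e , e≅Θ , s∈e) s≢g w
        with y , g~y , p ← edgeAt Θ g∈Θ = Θ≇ (≅-trans Θ (edge g y g~y) (down g) (≅-sym (edge g y g~y) Θ p)
        (walk⇒down (≢-sym (end w)) g~y (join
          (≅⇒inseparable (edge g y g~y) e (≅-trans (edge g y g~y) Θ e p (≅-sym e Θ e≅Θ))
            g y s (inj₂ refl) s∈e (≢-sym (~⇒≢ g~y)) s≢g) w)))

      -- On a walk to `r`, whichever of `g` and `h` is visited last reaches `r` without the other,
      -- against `gate-separates`.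
      gate-unique : ∀ Θ {g h} → Gate Θ g → Gate Θ h → g ≡ h
      gate-unique Θ {g} {h} Gg Gh with em {g ≡ h}
      ... | yes g≡h = g≡h
      ... | no g≢h  = ⊥-elim (last (lastVisit T (star⇒walk (connected g r))))
        where
        T : Pred V 0ℓ
        T t = t ≡ g ⊎ t ≡ h
        avoid : ∀ {z t} → z ≢ t → T t → LastVisit T z r → Walk (_≢ t) z r
        avoid z≢t Tt (inj₁ refl)           = here z≢t
        avoid z≢t Tt (inj₂ (_ , z~b , w)) = step z≢t z~b (widen (λ { (_ , ¬Ts) refl → ¬Ts Tt }) w)
        last : ¬ (Walk (U ∖ T) g r ⊎ (∃[ z ] T z × z ∈ U × LastVisit T z r))
        last (inj₁ w)                          = proj₂ (start w) (inj₁ refl)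
        last (inj₂ (_ , inj₁ refl , _ , l)) =
          gate-separates Θ Gh (proj₁ Gg) g≢h (avoid g≢h (inj₂ refl) l)
        last (inj₂ (_ , inj₂ refl , _ , l)) =
          gate-separates Θ Gg (proj₁ Gh) (≢-sym g≢h) (avoid (≢-sym g≢h) (inj₁ refl) l)

      -- Lets a lobe be recovered from any of its vertices other than the gate.
      nongate : ∀ Θ {g x} → Gate Θ g → VLobe Θ x → x ≢ g → x ≢ r × Θ ≅ down x
      nongate Θ {g} {x} Gg x∈Θ x≢g with em {x ≡ r} | em {Θ ≅ down x}
      ... | yes x≡r | _     = contradiction (gate-unique Θ (x∈Θ , inj₁ x≡r) Gg) x≢g
      ... | no x≢r | yes p  = x≢r , p
      ... | no _   | no Θ≇  = contradiction (gate-unique Θ (x∈Θ , inj₂ Θ≇) Gg) x≢g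

      gate-down : ∀ {x g} → x ≢ r → Gate (down x) g → x ≢ g
      gate-down x≢r (_ , inj₁ refl) refl = x≢r refl
      gate-down {x} x≢r (_ , inj₂ ¬p) refl = ¬p (≅-refl (down x))

      -- Recursion along one fixed walk to `r` stands in for the depth in the tree of lobes: by
      -- `gate-separates`, the gate of `down a` lies on the part of the walk after `a`.
      gate-induction : (X : V → Set) → X r →
        (∀ {x g} → x ≢ r → Gate (down x) g → X g → X x) → ∀ x → X x
      gate-induction X Xr Xstep x = go w₀ (onStart w₀)
        where
        w₀ : Walk U x r
        w₀ = star⇒walk (connected x r)
        go : ∀ {a t} (w : Walk U a r) → On w t → X t
        go (here _) refl             = Xr
        go (step _ _ w) (inj₂ t∈w)   = go w t∈w
        go (step {a} _ e w) (inj₁ refl) with em {a ≡ r} | gate-exists (down a)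
        ... | yes refl | _ = Xr
        ... | no a≢r | g , Gg with em {On w g}
        ...   | yes g∈w = Xstep a≢r Gg (go w g∈w)
        ...   | no g∉w  = contradiction
                (step a≢g e (widen (λ { t∈w refl → g∉w t∈w }) (restrict w)))
                (gate-separates (down a) Gg (∈down a) a≢g)
          where a≢g = gate-down a≢r Gg

-- Isomorphisms of lobes, and the action of automorphisms on lobes.

lobeIso-∘ : ∀ {Γ : Graph} (Λ Λ′ Λ″ : Lobe Γ) → LobeIso Λ′ Λ″ → LobeIso Λ Λ′ → LobeIso Λ Λ″
lobeIso-∘ _ _ _ g f = record
  { bijection = record
    { to = G.to ∘ F.to
    ; from = F.from ∘ G.from
    ; to-cong = λ {u} {v} → G.to-cong {F.to u} {F.to v} ∘ F.to-cong {u} {v}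
    ; from-cong = λ {u} {v} → F.from-cong {G.from u} {G.from v} ∘ G.from-cong {u} {v}
    ; inverse = (λ {x} {y} eq → G.inverseˡ {x} {F.to y} (F.inverseˡ {G.from x} {y} eq)) ,
                (λ {x} {y} eq → F.inverseʳ {x} {G.from y} (G.inverseʳ {F.to x} {y} eq))
    }
  ; adjacency = λ u v → mk⇔
      (Equivalence.to (Isomorphism.adjacency g (F.to u) (F.to v)) ∘ Equivalence.to (Isomorphism.adjacency f u v))
      (Equivalence.from (Isomorphism.adjacency f u v) ∘ Equivalence.from (Isomorphism.adjacency g (F.to u) (F.to v)))
  }
  where
  module F = Inverse (Isomorphism.bijection f)
  module G = Inverse (Isomorphism.bijection g)

module Automorphisms (em : ExcludedMiddle 0ℓ) (Γ : Graph) (connected : Connected Γ) where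
  open Graph Γ
  open Edge
  open LobeTheory em Γ
  open Lobes connected

  infixl 20 _·_
  _·_ : Aut Γ → V → V
  α · v = Isomorphism.to α v

  infixr 9 _∘ᴬ_
  _∘ᴬ_ : Aut Γ → Aut Γ → Aut Γ
  β ∘ᴬ α = record
    { bijection = mk↔ₛ′ (B.to ∘ A.to) (A.from ∘ B.from)
        (λ v → trans (cong B.to (A.strictlyInverseˡ (B.from v))) (B.strictlyInverseˡ v))
        (λ v → trans (cong A.from (B.strictlyInverseʳ (A.to v))) (A.strictlyInverseʳ v))
    ; adjacency = λ u v → mk⇔
        (Equivalence.to (Isomorphism.adjacency β (A.to u) (A.to v)) ∘ Equivalence.to (Isomorphism.adjacency α u v))
        (Equivalence.from (Isomorphism.adjacency α u v) ∘ Equivalence.from (Isomorphism.adjacency β (A.to u) (A.to v)))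
    }
    where
    module A = Inverse (Isomorphism.bijection α)
    module B = Inverse (Isomorphism.bijection β)

  idᴬ : Aut Γ
  idᴬ = record { bijection = mk↔ₛ′ id id (λ _ → refl) (λ _ → refl) ; adjacency = λ _ _ → mk⇔ id id }

  image : Aut Γ → Edge Γ → Edge Γ
  image = mapEdge {Γ}

  module _ (α : Aut Γ) where
    private module A = Inverse (Isomorphism.bijection α)

    _⁻¹ : Aut Γ
    _⁻¹ = record
      { bijection = mk↔ₛ′ A.from A.to A.strictlyInverseʳ A.strictlyInverseˡ
      ; adjacency = λ u v → mk⇔
          (λ u~v → Equivalence.from (Isomorphism.adjacency α (A.from u) (A.from v))
            (subst₂ _~_ (sym (A.strictlyInverseˡ u)) (sym (A.strictlyInverseˡ v)) u~v))
          (λ fu~fv → subst₂ _~_ (A.strictlyInverseˡ u) (A.strictlyInverseˡ v)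
            (Equivalence.to (Isomorphism.adjacency α (A.from u) (A.from v)) fu~fv))
      }

    inverseˡ : ∀ v → _⁻¹ · (α · v) ≡ v
    inverseˡ = A.strictlyInverseʳ

    inverseʳ : ∀ v → α · (_⁻¹ · v) ≡ v
    inverseʳ = A.strictlyInverseˡ

    injective : ∀ {u v} → α · u ≡ α · v → u ≡ v
    injective {u} {v} eq = trans (sym (inverseˡ u)) (trans (cong A.from eq) (inverseˡ v))

    liesOn-map : ∀ (e : Edge Γ) ws → LiesOn e ws → LiesOn (image α e) (map A.to ws)
    liesOn-map e _ = Sum.map consecutive consecutive
      where
      consecutive : ∀ {u v ws} → Consecutive {Γ} u v ws → Consecutive {Γ} (A.to u) (A.to v) (map A.to ws)
      consecutive {u} {v} (ps , qs , refl) = map A.to ps , map A.to qs , map-++ A.to ps (u ∷ v ∷ qs)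

    image-≅ : ∀ (e f : Edge Γ) → e ≅ f → image α e ≅ image α f
    image-≅ e f (inj₁ same) = inj₁ (Sum.map both both same)
      where
      both : ∀ {u v w z} → u ≡ v × w ≡ z → A.to u ≡ A.to v × A.to w ≡ A.to z
      both (p , q) = cong A.to p , cong A.to q
    image-≅ e f (inj₂ (x , xs , C , onE , onF)) = inj₂ (A.to x , map A.to xs , cycle , on e onE , on f onF)
      where
      closed : map A.to (x ∷ xs ∷ʳ x) ≡ A.to x ∷ map A.to xs ∷ʳ A.to x
      closed = cong (A.to x ∷_) (map-++ A.to xs (x ∷ []))
      on : ∀ g → LiesOn g (x ∷ xs ∷ʳ x) → LiesOn (image α g) (A.to x ∷ map A.to xs ∷ʳ A.to x)
      on g l = subst (LiesOn (image α g)) closed (liesOn-map g _ l)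
      cycle : IsCycle {Γ} (A.to x) (map A.to xs)
      cycle = record
        { closedWalk = subst (Linked _~_) closed (Linkedₚ.map⁺
            (Linked.map (λ {u} {v} → Equivalence.to (Isomorphism.adjacency α u v)) (IsCycle.closedWalk C)))
        ; distinct = Uniqueₚ.map⁺ injective (IsCycle.distinct C)
        ; long = subst (2 ≤_) (sym (length-map A.to xs)) (IsCycle.long C)
        }

  image-⁻¹ : ∀ α (e : Edge Γ) → image α (image (α ⁻¹) e) ≅ e
  image-⁻¹ α e = inj₁ (inj₁ (inverseʳ α (end₁ e) , inverseʳ α (end₂ e)))

  ⁻¹-image : ∀ α (e : Edge Γ) → image (α ⁻¹) (image α e) ≅ e
  ⁻¹-image α e = inj₁ (inj₁ (inverseˡ α (end₁ e) , inverseˡ α (end₂ e)))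

  mapsOnto-id : ∀ Λ → MapsOnto {Γ} idᴬ Λ Λ
  mapsOnto-id Λ e = mk⇔ id id

  mapsOnto-∘ : ∀ β α Λ Λ′ Λ″ → MapsOnto β Λ′ Λ″ → MapsOnto α Λ Λ′ → MapsOnto (β ∘ᴬ α) Λ Λ″
  mapsOnto-∘ β α _ _ _ q p e = mk⇔
    (Equivalence.to (q (image α e)) ∘ Equivalence.to (p e))
    (Equivalence.from (p e) ∘ Equivalence.from (q (image α e)))

  mapsOnto-⁻¹ : ∀ α Λ Λ′ → MapsOnto α Λ Λ′ → MapsOnto (α ⁻¹) Λ′ Λ
  mapsOnto-⁻¹ α Λ Λ′ p e = mk⇔
    (λ e∈Λ′ → Equivalence.from (p f) (≅-trans (image α f) e Λ′ (image-⁻¹ α e) e∈Λ′))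
    (λ f∈Λ → ≅-trans e (image α f) Λ′ (≅-sym (image α f) e (image-⁻¹ α e)) (Equivalence.to (p f) f∈Λ))
    where
    f : Edge Γ
    f = image (α ⁻¹) e

  mapsOnto-image : ∀ α Λ → MapsOnto α Λ (image α Λ)
  mapsOnto-image α Λ e = mk⇔ (image-≅ α e Λ) λ p →
    ≅-trans e (back e) Λ (≅-sym (back e) e (⁻¹-image α e))
      (≅-trans (back e) (back Λ) Λ (image-≅ (α ⁻¹) (image α e) (image α Λ) p) (⁻¹-image α Λ))
    where
    back : Edge Γ → Edge Γ
    back f = image (α ⁻¹) (image α f)

  mapsOnto-cong : ∀ α Λ Λ′ Λ″ → Λ′ ≅ Λ″ → MapsOnto α Λ Λ′ → MapsOnto α Λ Λ″
  mapsOnto-cong α Λ Λ′ Λ″ Λ′≅Λ″ p e = mk⇔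
    (λ e∈Λ → ≅-trans (image α e) Λ′ Λ″ (Equivalence.to (p e) e∈Λ) Λ′≅Λ″)
    (λ αe∈Λ″ → Equivalence.from (p e) (≅-trans (image α e) Λ″ Λ′ αe∈Λ″ (≅-sym Λ′ Λ″ Λ′≅Λ″)))

  vlobe-map : ∀ α Λ Λ′ → MapsOnto α Λ Λ′ → ∀ {v} → VLobe Λ v → VLobe Λ′ (α · v)
  vlobe-map α Λ Λ′ p (e , e∈Λ , v∈e) =
    image α e , Equivalence.to (p e) e∈Λ , Sum.map (cong (α ·_)) (cong (α ·_)) v∈e

  restrictToLobe : ∀ α Λ Λ′ → MapsOnto α Λ Λ′ → LobeIso Λ Λ′
  restrictToLobe α Λ Λ′ p = record
    { bijection = record
      { to = λ (v , v∈Λ) → α · v , vlobe-map α Λ Λ′ p v∈Λ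
      ; from = λ (v , v∈Λ′) → α ⁻¹ · v , vlobe-map (α ⁻¹) Λ′ Λ (mapsOnto-⁻¹ α Λ Λ′ p) v∈Λ′
      ; to-cong = cong (α ·_)
      ; from-cong = cong (α ⁻¹ ·_)
      ; inverse = (λ {x} eq → trans (cong (α ·_) eq) (inverseʳ α (proj₁ x))) ,
                  (λ {x} eq → trans (cong (α ⁻¹ ·_) eq) (inverseˡ α (proj₁ x)))
      }
    ; adjacency = λ (u , _) (v , _) → mk⇔
        (λ (u~v , e∈Λ) → Equivalence.to (Isomorphism.adjacency α u v) u~v ,
          Equivalence.to (p (edge u v u~v)) e∈Λ)
        (λ (αu~αv , αe∈Λ′) → let u~v = Equivalence.from (Isomorphism.adjacency α u v) αu~αv in
          u~v , Equivalence.from (p (edge u v u~v)) αe∈Λ′)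
    }

-- Orbits of the stabilizer of `Λ₀` and their canonical representatives.

module StabilizerOrbits (em : ExcludedMiddle 0ℓ) (Γ : Graph) (connected : Connected Γ)
  (code : Graph.V Γ → ℕ) (code-injective : ∀ {u v} → code u ≡ code v → u ≡ v) (Λ₀ : Lobe Γ) where
  open Graph Γ
  open Edge
  open LobeTheory em Γ
  open Lobes connected
  open Automorphisms em Γ connected
  open Classical em

  V₀ : Set
  V₀ = Σ V (VLobe Λ₀)

  infix 4 _≈_
  _≈_ : V → V → Set
  _≈_ = Orbit {Γ} (Stabilizer Λ₀)

  ≈-refl : ∀ v → v ≈ v
  ≈-refl v = idᴬ , mapsOnto-id Λ₀ , refl

  ≈-sym : ∀ {u v} → u ≈ v → v ≈ u
  ≈-sym {u} (α , s , refl) = α ⁻¹ , mapsOnto-⁻¹ α Λ₀ Λ₀ s , inverseˡ α u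

  ≈-trans : ∀ {u v w} → u ≈ v → v ≈ w → u ≈ w
  ≈-trans (α , s , refl) (β , t , refl) = β ∘ᴬ α , mapsOnto-∘ β α Λ₀ Λ₀ Λ₀ t s , refl

  orbit⊆Λ₀ : ∀ {q} → VLobe Λ₀ q → Orbit {Γ} (Stabilizer Λ₀) q ⊆ VLobe Λ₀
  orbit⊆Λ₀ q∈Λ₀ (α , s , refl) = vlobe-map α Λ₀ Λ₀ s q∈Λ₀

  end₀ : VLobe Λ₀ (end₁ Λ₀)
  end₀ = Λ₀ , ≅-refl Λ₀ , inj₁ refl

  abstract
    private
      HasCode : V → ℕ → Set
      HasCode q k = ∃[ v ] q ≈ v × code v ≡ k

      leastCode : ∀ q → ∃ (Least (HasCode q))
      leastCode q = least (code q , q , ≈-refl q , refl)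

    -- The orbit element of least code; it turns equality of types into equality of vertices.
    canon : V → V
    canon q = proj₁ (proj₁ (proj₂ (leastCode q)))

    ≈-canon : ∀ q → q ≈ canon q
    ≈-canon q with leastCode q
    ... | _ , (_ , q≈v , _) , _ = q≈v

    canon-cong : ∀ {q q′} → q ≈ q′ → canon q ≡ canon q′
    canon-cong {q} {q′} q≈q′ with leastCode q | leastCode q′
    ... | k , l@((v , _ , refl) , _) | k′ , l′@((v′ , _ , refl) , _) = code-injective (least-unique
      {HasCode q} {HasCode q′}
      (λ (w , q≈w , p) → w , ≈-trans (≈-sym q≈q′) q≈w , p)
      (λ (w , q′≈w , p) → w , ≈-trans q≈q′ q′≈w , p) l l′)

  canon∈Λ₀ : ∀ {q} → VLobe Λ₀ q → VLobe Λ₀ (canon q)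
  canon∈Λ₀ {q} q∈Λ₀ = orbit⊆Λ₀ q∈Λ₀ (≈-canon q)

  fromCanon : (q : V) → canon q ≈ q
  fromCanon q = ≈-sym (≈-canon q)

  canonIso : V → LobeIso Λ₀ Λ₀
  canonIso q = restrictToLobe (proj₁ (fromCanon q)) Λ₀ Λ₀ (proj₁ (proj₂ (fromCanon q)))

  abstract
    -- The default value is only taken at vertices outside Λ₀.
    orbitAt : V → J Λ₀
    orbitAt q with em {Orbit {Γ} (Stabilizer Λ₀) q ⊆ VLobe Λ₀}
    ... | yes q⊆ = q , q⊆
    ... | no _   = end₁ Λ₀ , orbit⊆Λ₀ end₀

    orbitAt-base : ∀ {q} → VLobe Λ₀ q → proj₁ (orbitAt q) ≡ q
    orbitAt-base {q} q∈Λ₀ with em {Orbit {Γ} (Stabilizer Λ₀) q ⊆ VLobe Λ₀}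
    ... | yes _  = refl
    ... | no ¬q⊆ = contradiction (λ {_} → orbit⊆Λ₀ q∈Λ₀) ¬q⊆

-- From a family of isomorphisms with constant counts to lobe-transitivity: charts and types.

module Extension (em : ExcludedMiddle 0ℓ) (Γ : Graph) (connected : Connected Γ)
  (code : Graph.V Γ → ℕ) (code-injective : ∀ {u v} → code u ≡ code v → u ≡ v) (Λ₀ : Lobe Γ)
  (F : IsoFamily Λ₀) (τ : J Λ₀ → Graph.V Γ → ℕ∪ℵ₀)
  (τ-count : ∀ j → IsoFamily.IsCount F j (τ j))
  (τ-const : ∀ j i u v → u ∈ P Γ i → v ∈ P Γ i → τ j u ≡ τ j v)
  (τ-positive : ∀ j v → Positive (τ j v) → v ∈ PContaining Λ₀ j) where
  open Graph Γ
  open Edge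
  open LobeTheory em Γ
  open Lobes connected
  open StabilizerOrbits em Γ connected code code-injective Λ₀
  open IsoFamily F

  module σ Λ = Isomorphism (σ Λ)
  module σ⁻¹ Λ = Inverse (σ.bijection Λ)

  coord : ∀ Θ {g} → VLobe Θ g → V₀
  coord Θ {g} g∈Θ = σ.from Θ (g , g∈Θ)

  σ-coord : ∀ Θ {g} (g∈Θ : VLobe Θ g) → proj₁ (σ.to Θ (coord Θ g∈Θ)) ≡ g
  σ-coord Θ {g} g∈Θ = σ⁻¹.strictlyInverseˡ Θ (g , g∈Θ)

  coord-unique : ∀ Θ {g} (g∈Θ : VLobe Θ g) (p : V₀) → proj₁ (σ.to Θ p) ≡ g →
    proj₁ (coord Θ g∈Θ) ≡ proj₁ p
  coord-unique Θ g∈Θ p eq = σ⁻¹.inverseʳ Θ {p} (sym eq)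

  coord-cong : ∀ Θ Θ′ {g} (m : VLobe Θ g) (m′ : VLobe Θ′ g) → Θ ≅ Θ′ →
    proj₁ (coord Θ m) ≡ proj₁ (coord Θ′ m′)
  coord-cong Θ Θ′ m m′ Θ≅Θ′ = coord-unique Θ m (coord Θ′ m′)
    (trans (σ-wellDefined Θ Θ′ Θ≅Θ′ _) (σ-coord Θ′ m′))

  canonAt : ∀ Θ {g} → VLobe Θ g → V
  canonAt Θ m = canon (proj₁ (coord Θ m))

  canonPoint : ∀ Θ {g} → VLobe Θ g → V₀
  canonPoint Θ m = canonAt Θ m , canon∈Λ₀ (proj₂ (coord Θ m))

  -- σ_Θ is normalised by an element of Stab(Λ₀) so that the canonical
  -- representative of the type of g is sent to g.  The charts of two lobes at
  -- vertices of the same type then differ by an isomorphism matching these vertices.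
  chartIso : ∀ Θ {g} → VLobe Θ g → LobeIso Λ₀ Θ
  chartIso Θ m = lobeIso-∘ Λ₀ Λ₀ Θ (σ Θ) (canonIso (proj₁ (coord Θ m)))

  chart : ∀ Θ {g} → VLobe Θ g → V₀ → V
  chart Θ m p = proj₁ (Isomorphism.to (chartIso Θ m) p)

  chart∈ : ∀ Θ {g} (m : VLobe Θ g) p → VLobe Θ (chart Θ m p)
  chart∈ Θ m p = proj₂ (Isomorphism.to (chartIso Θ m) p)

  chart-base : ∀ Θ {g} (m : VLobe Θ g) → chart Θ m (canonPoint Θ m) ≡ g
  chart-base Θ m = trans (σ⁻¹.to-cong Θ (proj₂ (proj₂ (fromCanon _)))) (σ-coord Θ m)

  chart-injective : ∀ Θ {g} (m : VLobe Θ g) p p′ → chart Θ m p ≡ chart Θ m p′ → proj₁ p ≡ proj₁ p′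
  chart-injective Θ m p p′ eq = trans (sym (c.inverseʳ {p} {c.to p} refl)) (c.inverseʳ {p′} eq)
    where module c = Inverse (Isomorphism.bijection (chartIso Θ m))

  chart-surjective : ∀ Θ {g} (m : VLobe Θ g) {x} → VLobe Θ x → ∃[ p ] chart Θ m p ≡ x
  chart-surjective Θ m {x} x∈Θ = c.from (x , x∈Θ) , c.strictlyInverseˡ (x , x∈Θ)
    where module c = Inverse (Isomorphism.bijection (chartIso Θ m))

  chart-cong : ∀ Θ Θ′ {g} (m : VLobe Θ g) (m′ : VLobe Θ′ g) → Θ ≅ Θ′ →
    ∀ p p′ → proj₁ p ≡ proj₁ p′ → chart Θ m p ≡ chart Θ′ m′ p′
  chart-cong Θ Θ′ m m′ Θ≅Θ′ p p′ eq =
    trans (σ-wellDefined Θ Θ′ Θ≅Θ′ _) (σ⁻¹.to-cong Θ′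
      (cong₂ (λ q v → Isomorphism.to (proj₁ (fromCanon q)) v) (coord-cong Θ Θ′ m m′ Θ≅Θ′) eq))

  num : ∀ j v → Numbering (LobesThrough j v) (λ Λ Λ′ → proj₁ Λ ≅ proj₁ Λ′) (τ j v)
  num j v = numbering (λ a → ≅-refl (proj₁ a)) (τ j v) (τ-count j v)

  image-cong : ∀ Θ Θ′ → Θ ≅ Θ′ → ∀ {X v} → v ∈ Image Θ X → v ∈ Image Θ′ X
  image-cong Θ Θ′ Θ≅Θ′ (x , x∈X , eq) = x , x∈X , trans (sym (σ-wellDefined Θ Θ′ Θ≅Θ′ x)) eq

  num-cong : ∀ j v Θ Θ′ (i : v ∈ Image Θ (Q Λ₀ j)) (i′ : v ∈ Image Θ′ (Q Λ₀ j)) → Θ ≅ Θ′ →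
    Numbering.index (num j v) (Θ , i) ≡ Numbering.index (num j v) (Θ′ , i′)
  num-cong j v Θ Θ′ i i′ = Numbering.congruent (num j v) {Θ , i} {Θ′ , i′}

  through : ∀ Θ {g} (m : VLobe Θ g) → g ∈ Image Θ (Q Λ₀ (orbitAt (canonAt Θ m)))
  through Θ m = coord Θ m ,
    subst (_≈ proj₁ (coord Θ m)) (sym (orbitAt-base (proj₂ (canonPoint Θ m)))) (fromCanon _) ,
    σ-coord Θ m

  Alike : Lobe Γ → V → Lobe Γ → V → Set
  Alike Θ x Θ′ y = Σ[ p ∈ V₀ ] Σ[ p′ ∈ V₀ ]
    proj₁ p ≈ proj₁ p′ × proj₁ (σ.to Θ p) ≡ x × proj₁ (σ.to Θ′ p′) ≡ y

  alike-sym : ∀ Θ x Θ′ y → Alike Θ x Θ′ y → Alike Θ′ y Θ x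
  alike-sym _ _ _ _ (p , p′ , p≈p′ , px , p′y) = p′ , p , ≈-sym p≈p′ , p′y , px

  alike-cong : ∀ Θ₁ Θ₂ Θ₁′ Θ₂′ {x y} → Θ₁ ≅ Θ₂ → Θ₁′ ≅ Θ₂′ → Alike Θ₁ x Θ₁′ y → Alike Θ₂ x Θ₂′ y
  alike-cong Θ₁ Θ₂ Θ₁′ Θ₂′ e e′ (p , p′ , p≈p′ , px , p′y) = p , p′ , p≈p′ ,
    trans (sym (σ-wellDefined Θ₁ Θ₂ e p)) px , trans (sym (σ-wellDefined Θ₁′ Θ₂′ e′ p′)) p′y

  alike⇒canonAt : ∀ Θ {x} Θ′ {y} (m : VLobe Θ x) (m′ : VLobe Θ′ y) → Alike Θ x Θ′ y →
    canonAt Θ m ≡ canonAt Θ′ m′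
  alike⇒canonAt Θ Θ′ m m′ (p , p′ , p≈p′ , px , p′y) = trans (cong canon (coord-unique Θ m p px))
    (trans (canon-cong p≈p′) (cong canon (sym (coord-unique Θ′ m′ p′ p′y))))

  alike⇒τ≡ : ∀ {Θ x Θ′ y} → Alike Θ x Θ′ y → ∀ k → τ k x ≡ τ k y
  alike⇒τ≡ {Θ} {x} {Θ′} {y} (p , p′ , p≈p′ , px , p′y) k = τ-const k (proj₁ p) x y
    (inOrbit x (Θ , p , ≈-refl _ , px)) (inOrbit y (Θ′ , p′ , p≈p′ , p′y))
    where
    j : J Λ₀
    j = proj₁ p , orbit⊆Λ₀ (proj₂ p)
    inOrbit : ∀ v → LobesThrough j v → v ∈ P Γ (proj₁ p)
    inOrbit v ℓ = τ-positive j v (inhabited⇒positive (τ j v) (num j v) ℓ)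

  -- Labels of the lobes at a vertex, relative to a root.

  record Root : Set where
    constructor root
    field
      vertex  : V
      lobe    : Lobe Γ
      vertex∈ : VLobe lobe vertex

  open Root
  module At (ρ : Root) = Rooted (vertex ρ) (lobe ρ) (vertex∈ ρ)

  abstract
    shift : Root → J Λ₀ → V → ℕ
    shift ρ j g with em {g ∈ Image (At.down ρ g) (Q Λ₀ j)}
    ... | yes i = Numbering.index (num j g) (At.down ρ g , i)
    -- When the lobe towards the root has another type, the value 0 makes `swap₀` the identity.
    ... | no _  = 0

    shift-down : ∀ ρ j g Θ (i : g ∈ Image Θ (Q Λ₀ j)) → Θ ≅ At.down ρ g →
      shift ρ j g ≡ Numbering.index (num j g) (Θ , i)
    shift-down ρ j g Θ i Θ≅ with em {g ∈ Image (At.down ρ g) (Q Λ₀ j)}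
    ... | yes i′ = sym (num-cong j g Θ (At.down ρ g) i i′ Θ≅)
    ... | no ¬i  = contradiction (image-cong Θ (At.down ρ g) Θ≅ i) ¬i

    shift-< : ∀ ρ j g {k} → k <∞ τ j g → shift ρ j g <∞ τ j g
    shift-< ρ j g k<τ with em {g ∈ Image (At.down ρ g) (Q Λ₀ j)}
    ... | yes i = Numbering.bounded (num j g) (At.down ρ g , i)
    ... | no _  = zero<∞ (τ j g) k<τ

  -- The lobes through g of one type are numbered so that the one leading to
  -- the root, if present, gets number 0.
  rank : ∀ ρ j g Θ → g ∈ Image Θ (Q Λ₀ j) → ℕ
  rank ρ j g Θ i = swap₀ (shift ρ j g) (Numbering.index (num j g) (Θ , i))

  -- The type `q` and the rank `k` together single out one lobe through `g`. This is a relation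
  -- because both are computed from membership proofs; `label-unique` shows that these do not
  -- matter.
  record HasLabel (ρ : Root) (g : V) (Θ : Lobe Γ) (q : V) (k : ℕ) : Set where
    field
      member  : VLobe Θ g
      kind    : canonAt Θ member ≡ q
      passes  : g ∈ Image Θ (Q Λ₀ (orbitAt q))
      ranked  : rank ρ (orbitAt q) g Θ passes ≡ k

  open HasLabel

  label : ∀ ρ Θ {g} → VLobe Θ g → ∃₂ (HasLabel ρ g Θ)
  label ρ Θ m = _ , _ , record { member = m ; kind = refl ; passes = through Θ m ; ranked = refl }

  module _ (ρ : Root) where

    label-unique : ∀ {g} Θ Θ′ {q q′ k k′} → Θ ≅ Θ′ → HasLabel ρ g Θ q k → HasLabel ρ g Θ′ q′ k′ →
      q ≡ q′ × k ≡ k′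
    label-unique {g} Θ Θ′ {q} {q′} Θ≅Θ′ l l′ = q≡q′ , ranks q≡q′ (passes l) (passes l′) (ranked l) (ranked l′)
      where
      q≡q′ : q ≡ q′
      q≡q′ = trans (sym (kind l)) (trans (cong canon (coord-cong Θ Θ′ (member l) (member l′) Θ≅Θ′)) (kind l′))
      ranks : ∀ {q q′ k k′} → q ≡ q′ → ∀ i i′ → rank ρ (orbitAt q) g Θ i ≡ k →
        rank ρ (orbitAt q′) g Θ′ i′ ≡ k′ → k ≡ k′
      ranks refl i i′ refl refl = cong (swap₀ (shift ρ _ g)) (num-cong _ g Θ Θ′ i i′ Θ≅Θ′)

    label-injective : ∀ {g} Θ Θ′ {q k} → HasLabel ρ g Θ q k → HasLabel ρ g Θ′ q k → Θ ≅ Θ′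
    label-injective {g} Θ Θ′ {q} l l′ = Numbering.injective (num (orbitAt q) g)
      {Θ , passes l} {Θ′ , passes l′} (begin
        n                 ≡⟨ swap₀-involutive d n ⟨
        swap₀ d (swap₀ d n)  ≡⟨ cong (swap₀ d) (trans (ranked l) (sym (ranked l′))) ⟩
        swap₀ d (swap₀ d n′) ≡⟨ swap₀-involutive d n′ ⟩
        n′                ∎)
      where
      open ≡-Reasoning
      d n n′ : ℕ
      d  = shift ρ (orbitAt q) g
      n  = Numbering.index (num (orbitAt q) g) (Θ , passes l)
      n′ = Numbering.index (num (orbitAt q) g) (Θ′ , passes l′)

    label-down : ∀ {g} Θ {q k} → Θ ≅ At.down ρ g → HasLabel ρ g Θ q k → k ≡ 0
    label-down {g} Θ {q} Θ≅ l = trans (sym (ranked l))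
      (trans (cong (λ d → swap₀ d n) (shift-down ρ _ g Θ (passes l) Θ≅)) (swap₀-self n))
      where
      n : ℕ
      n = Numbering.index (num (orbitAt q) g) (Θ , passes l)

  -- Equal counts make `k` an admissible rank at `g′` too. The lobe sought is the one with index
  -- `swap₀ d′ k`, since the swap is an involution.
  matching : ∀ ρ ρ′ {g g′} Θ {q k} → (∀ j → τ j g ≡ τ j g′) → HasLabel ρ g Θ q k →
    ∃[ Θ′ ] HasLabel ρ′ g′ Θ′ q k
  matching ρ ρ′ {g} {g′} Θ {q} {k} τ≡ l =
    Θ′ , record
      { member = m′
      ; kind   = begin
          canonAt Θ′ m′    ≡⟨ cong canon (coord-unique Θ′ m′ x σx≡g′) ⟩
          canon (proj₁ x)  ≡⟨ canon-cong (subst (_≈ proj₁ x) q-base x∈Q) ⟨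
          -- Being a value of `canon`, the vertex `q` is fixed by `canon`.
          canon q          ≡⟨ cong canon (kind l) ⟨
          canon (canonAt Θ (member l))  ≡⟨ canon-cong (fromCanon (proj₁ (coord Θ (member l)))) ⟩
          canonAt Θ (member l) ≡⟨ kind l ⟩
          q ∎
      ; passes = i′
      ; ranked = trans (cong (swap₀ d′) (proj₂ found)) (swap₀-involutive d′ k)
      }
    where
    open ≡-Reasoning
    j : J Λ₀
    j = orbitAt q
    d′ : ℕ
    d′ = shift ρ′ j g′
    k<τ : k <∞ τ j g
    k<τ = subst (_<∞ τ j g) (ranked l) (swap₀-< (τ j g) (shift-< ρ j g bound) bound)
      where bound = Numbering.bounded (num j g) (Θ , passes l)
    k<τ′ : k <∞ τ j g′
    k<τ′ = subst (k <∞_) (τ≡ j) k<τ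
    found : ∃[ ℓ ] Numbering.index (num j g′) ℓ ≡ swap₀ d′ k
    found = Numbering.covers (num j g′) (swap₀-< (τ j g′) (shift-< ρ′ j g′ k<τ′) k<τ′)
    Θ′ : Lobe Γ
    Θ′ = proj₁ (proj₁ found)
    i′ : g′ ∈ Image Θ′ (Q Λ₀ j)
    i′ = proj₂ (proj₁ found)
    x : V₀
    x = proj₁ i′
    x∈Q : proj₁ j ≈ proj₁ x
    x∈Q = proj₁ (proj₂ i′)
    σx≡g′ : proj₁ (σ.to Θ′ x) ≡ g′
    σx≡g′ = proj₂ (proj₂ i′)
    m′ : VLobe Θ′ g′
    m′ = subst (VLobe Θ′) σx≡g′ (proj₂ (σ.to Θ′ x))
    q-base : proj₁ j ≡ q
    q-base = orbitAt-base (subst (VLobe Λ₀) (kind l) (proj₂ (canonPoint Θ (member l))))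

  -- The correspondence between the vertices seen from two roots.

  record Link (ρ ρ′ : Root) (g g′ : V) (Θ Θ′ : Lobe Γ) : Set where
    field
      gate   : At.Gate ρ Θ g
      gate′  : At.Gate ρ′ Θ′ g′
      {q}    : V
      {k}    : ℕ
      label₁ : HasLabel ρ g Θ q k
      label₂ : HasLabel ρ′ g′ Θ′ q k

    -- The isomorphism between the two lobes sends `at p` to `at′ p`. Parametrising it by points of
    -- `Λ₀` keeps a link symmetric.
    at : V₀ → V
    at = chart Θ (proj₁ gate)

    at′ : V₀ → V
    at′ = chart Θ′ (proj₁ gate′)

  link-sym : ∀ {ρ ρ′ g g′ Θ Θ′} → Link ρ ρ′ g g′ Θ Θ′ → Link ρ′ ρ g′ g Θ′ Θ
  link-sym l = record { gate = gate′ ; gate′ = gate ; label₁ = label₂ ; label₂ = label₁ }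
    where open Link l

  -- The graph of the automorphism that carries the root ρ to the root ρ′, lobe
  -- by lobe outwards.
  data Corresponds (ρ ρ′ : Root) : V → V → Set where
    base : Corresponds ρ ρ′ (vertex ρ) (vertex ρ′)
    step : ∀ {g g′ Θ Θ′ x y} → Corresponds ρ ρ′ g g′ → (l : Link ρ ρ′ g g′ Θ Θ′) (p : V₀) →
      Link.at l p ≡ x → Link.at′ l p ≡ y → Corresponds ρ ρ′ x y

  -- Supplies the inverse map and the converse of adjacency in `extension`.
  corresponds-sym : ∀ {ρ ρ′ x y} → Corresponds ρ ρ′ x y → Corresponds ρ′ ρ y x
  corresponds-sym base             = base
  corresponds-sym (step t l p e e′) = step (corresponds-sym t) (link-sym l) p e′ e

  module _ {ρ ρ′ : Root} {g g′ : V} {Θ Θ′ : Lobe Γ} (l : Link ρ ρ′ g g′ Θ Θ′) where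
    open Link l

    canonAt-link : canonAt Θ (proj₁ gate) ≡ canonAt Θ′ (proj₁ gate′)
    canonAt-link = trans (same Θ (proj₁ gate) label₁) (sym (same Θ′ (proj₁ gate′) label₂))
      where
      same : ∀ {ρ g} Θ {q k} (m : VLobe Θ g) → HasLabel ρ g Θ q k → canonAt Θ m ≡ q
      same Θ m l = trans (cong canon (coord-cong Θ Θ m (member l) (≅-refl Θ))) (kind l)

    -- In both charts the gate has the canonical point of its type as coordinate, and equal labels
    -- mean equal types. A step that stays at the gate thus gives no new pair.
    at-gate : ∀ p → at p ≡ g → at′ p ≡ g′
    at-gate p eq = trans
      (chart-cong Θ′ Θ′ (proj₁ gate′) (proj₁ gate′) (≅-refl Θ′) p (canonPoint Θ′ (proj₁ gate′))
        (trans (chart-injective Θ (proj₁ gate) p (canonPoint Θ (proj₁ gate))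
          (trans eq (sym (chart-base Θ (proj₁ gate))))) canonAt-link))
      (chart-base Θ′ (proj₁ gate′))

    -- Both coordinates arise from the same `p` by elements of the stabilizer.
    at-alike : ∀ p → Alike Θ (at p) Θ′ (at′ p)
    at-alike p = point (coord Θ (proj₁ gate)) , point (coord Θ′ (proj₁ gate′)) ,
      ≈-trans (≈-sym (moved (coord Θ (proj₁ gate)))) (moved (coord Θ′ (proj₁ gate′))) , refl , refl
      where
      point : V₀ → V₀
      point c = Isomorphism.to (canonIso (proj₁ c)) p
      moved : ∀ c → proj₁ p ≈ proj₁ (point c)
      moved c with α , s , _ ← fromCanon (proj₁ c) = α , s , refl

  -- The first lobe fixes the label, the label fixes the second lobe, and a chart depends only on
  -- the lobe and the vertex.
  links-agree : ∀ {ρ ρ′ g g′ Θ₁ Θ₁′ h h′ Θ₂ Θ₂′}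
    (l₁ : Link ρ ρ′ g g′ Θ₁ Θ₁′) (l₂ : Link ρ ρ′ h h′ Θ₂ Θ₂′) → g ≡ h → g′ ≡ h′ → Θ₁ ≅ Θ₂ →
    ∀ p₁ p₂ → Link.at l₁ p₁ ≡ Link.at l₂ p₂ → Link.at′ l₁ p₁ ≡ Link.at′ l₂ p₂
  links-agree {ρ} {ρ′} {Θ₁ = Θ₁} {Θ₁′} {h′ = h′} {Θ₂} {Θ₂′} l₁ l₂ refl refl Θ₁≅Θ₂ p₁ p₂ eq =
    chart-cong Θ₁′ Θ₂′ (proj₁ M.gate′) (proj₁ N.gate′) Θ₁′≅Θ₂′ p₁ p₂ p₁≡p₂
    where
    module M = Link l₁
    module N = Link l₂
    p₁≡p₂ : proj₁ p₁ ≡ proj₁ p₂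
    p₁≡p₂ = chart-injective Θ₂ (proj₁ N.gate) p₁ p₂
      (trans (sym (chart-cong Θ₁ Θ₂ (proj₁ M.gate) (proj₁ N.gate) Θ₁≅Θ₂ p₁ p₁ refl)) eq)
    same : M.q ≡ N.q × M.k ≡ N.k
    same = label-unique ρ Θ₁ Θ₂ Θ₁≅Θ₂ M.label₁ N.label₁
    Θ₁′≅Θ₂′ : Θ₁′ ≅ Θ₂′
    Θ₁′≅Θ₂′ = label-injective ρ′ Θ₁′ Θ₂′ M.label₂
      (subst₂ (HasLabel ρ′ h′ Θ₂′) (sym (proj₁ same)) (sym (proj₂ same)) N.label₂)

  module _ {ρ ρ′ : Root} (compatible : Alike (lobe ρ) (vertex ρ) (lobe ρ′) (vertex ρ′)) where

    -- A step off the gate lands on vertices whose lobes towards the roots are the two lobes just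
    -- crossed, and these are alike there; at the roots themselves the convention for `down` reduces
    -- the claim to `compatible`.
    corresponds-invariant : ∀ {x y} → Corresponds ρ ρ′ x y →
      (x ≡ vertex ρ → y ≡ vertex ρ′) × (y ≡ vertex ρ′ → x ≡ vertex ρ) ×
      Alike (At.down ρ x) x (At.down ρ′ y) y
    corresponds-invariant base = (λ _ → refl) , (λ _ → refl) ,
      subst₂ (λ Λ Λ′ → Alike Λ _ Λ′ _) (sym (At.down-root ρ)) (sym (At.down-root ρ′)) compatible
    corresponds-invariant (step {g} {g′} {Θ} {Θ′} t l p refl refl) with em {Link.at l p ≡ g}
    ... | yes eq = subst₂ Invariant (sym eq) (sym (at-gate l p eq)) (corresponds-invariant t)
      where
      Invariant : V → V → Set
      Invariant x y = (x ≡ vertex ρ → y ≡ vertex ρ′) × (y ≡ vertex ρ′ → x ≡ vertex ρ) ×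
        Alike (At.down ρ x) x (At.down ρ′ y) y
    ... | no x≢g with At.nongate ρ Θ (Link.gate l) (chart∈ Θ _ p) x≢g
                    | At.nongate ρ′ Θ′ (Link.gate′ l) (chart∈ Θ′ _ p) (λ eq → x≢g (at-gate (link-sym l) p eq))
    ...   | x≢r , Θ≅ | y≢r′ , Θ′≅ = (λ x≡r → contradiction x≡r x≢r) , (λ y≡r′ → contradiction y≡r′ y≢r′) ,
            alike-cong Θ _ Θ′ _ Θ≅ Θ′≅ (at-alike l p)

    corresponds⇒τ≡ : ∀ {x y} → Corresponds ρ ρ′ x y → ∀ j → τ j x ≡ τ j y
    corresponds⇒τ≡ t = alike⇒τ≡ (proj₂ (proj₂ (corresponds-invariant t)))

    -- The lobes towards the roots have the same type by the invariant and rank 0 by construction,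
    -- so the labels match them with each other.
    corresponds⇒label-down : ∀ {x y} → Corresponds ρ ρ′ x y →
      ∃[ q ] HasLabel ρ x (At.down ρ x) q 0 × HasLabel ρ′ y (At.down ρ′ y) q 0
    corresponds⇒label-down {x} {y} t
      with label ρ (At.down ρ x) (At.∈down ρ x) | label ρ′ (At.down ρ′ y) (At.∈down ρ′ y)
    ... | q , k , l | q′ , k′ , l′
      with refl ← label-down ρ (At.down ρ x) (≅-refl (At.down ρ x)) l
         | refl ← label-down ρ′ (At.down ρ′ y) (≅-refl (At.down ρ′ y)) l′ =
      q , l , subst (λ q → HasLabel ρ′ y (At.down ρ′ y) q 0) (sym q≡q′) l′
      where
      q≡q′ : q ≡ q′
      q≡q′ = trans (sym (kind l)) (trans (alike⇒canonAt _ _ (member l) (member l′)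
        (proj₂ (proj₂ (corresponds-invariant t)))) (kind l′))

    -- The matched lobe must again lead away from the root. If it were `down g′`, its label would be
    -- that of `down g`, and `Θ` would be `down g`.
    extend : ∀ {g g′} Θ → Corresponds ρ ρ′ g g′ → At.Gate ρ Θ g → ∃[ Θ′ ] Link ρ ρ′ g g′ Θ Θ′
    extend {g} {g′} Θ t G = Θ′ , record
      { gate = G
      ; gate′ = member l′ , [ inj₁ ∘ proj₁ (corresponds-invariant t) , (λ Θ≇ → inj₂ (Θ≇ ∘ back)) ]′ (proj₂ G)
      ; label₁ = l ; label₂ = l′ }
      where
      q : V
      q = proj₁ (label ρ Θ (proj₁ G))
      k : ℕ
      k = proj₁ (proj₂ (label ρ Θ (proj₁ G)))
      l : HasLabel ρ g Θ q k
      l = proj₂ (proj₂ (label ρ Θ (proj₁ G)))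
      matched : ∃[ Θ′ ] HasLabel ρ′ g′ Θ′ q k
      matched = matching ρ ρ′ Θ (corresponds⇒τ≡ t) l
      Θ′ : Lobe Γ
      Θ′ = proj₁ matched
      l′ : HasLabel ρ′ g′ Θ′ q k
      l′ = proj₂ matched
      back : Θ′ ≅ At.down ρ′ g′ → Θ ≅ At.down ρ g
      back Θ′≅ = label-injective ρ Θ (At.down ρ g) l (subst₂ (HasLabel ρ g (At.down ρ g))
        (sym (proj₁ same)) (sym (proj₂ same)) (proj₁ (proj₂ (corresponds⇒label-down t))))
        where
        same : q ≡ proj₁ (corresponds⇒label-down t) × k ≡ 0
        same = label-unique ρ′ Θ′ (At.down ρ′ g′) Θ′≅ l′ (proj₂ (proj₂ (corresponds⇒label-down t)))

    corresponds-total : ∀ x → ∃[ y ] Corresponds ρ ρ′ x y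
    corresponds-total = At.gate-induction ρ (λ x → ∃[ y ] Corresponds ρ ρ′ x y) (vertex ρ′ , base) outward
      where
      outward : ∀ {x g} → x ≢ vertex ρ → At.Gate ρ (At.down ρ x) g →
        ∃[ y ] Corresponds ρ ρ′ g y → ∃[ y ] Corresponds ρ ρ′ x y
      outward {x} {g} x≢r G (g′ , t) = across (extend (At.down ρ x) t G)
        where
        across : ∃[ Θ′ ] Link ρ ρ′ g g′ (At.down ρ x) Θ′ → ∃[ y ] Corresponds ρ ρ′ x y
        across (Θ′ , l) = Link.at′ l (proj₁ onto) , step t l (proj₁ onto) (proj₂ onto) refl
          where
          onto : ∃[ p ] Link.at l p ≡ x
          onto = chart-surjective (At.down ρ x) (proj₁ (Link.gate l)) (At.∈down ρ x)

    -- A derivation of `Corresponds` may contain steps that stay at the gate. Once these are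
    -- discarded, the final step to `x` has to cross `down x`.
    record LastStep (x y : V) : Set where
      field
        {g g′}  : V
        {Θ Θ′} : Lobe Γ
        before : Corresponds ρ ρ′ g g′
        link   : Link ρ ρ′ g g′ Θ Θ′
        point  : V₀
        x≡     : Link.at link point ≡ x
        y≡     : Link.at′ link point ≡ y
        x≢g    : x ≢ g

    lastStep : ∀ {x y} → Corresponds ρ ρ′ x y → x ≢ vertex ρ → LastStep x y
    lastStep base x≢r = contradiction refl x≢r
    lastStep {x} {y} (step {g} {g′} t l p e e′) x≢r = decide
      (λ x≡g → subst₂ LastStep (sym x≡g) (trans (sym (at-gate l p (trans e x≡g))) e′)
        (lastStep t (λ g≡r → x≢r (trans x≡g g≡r))))
      (λ x≢g → record { before = t ; link = l ; point = p ; x≡ = e ; y≡ = e′ ; x≢g = x≢g })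
      where
      decide : (x ≡ g → LastStep x y) → (x ≢ g → LastStep x y) → LastStep x y
      decide f h with em {x ≡ g}
      ... | yes x≡g = f x≡g
      ... | no x≢g  = h x≢g

    -- Two final steps to `x` cross the same lobe from its unique gate; by induction the gate has
    -- one partner, and `links-agree` concludes.
    corresponds-functional : ∀ x {y z} → Corresponds ρ ρ′ x y → Corresponds ρ ρ′ x z → y ≡ z
    corresponds-functional x {y} {z} = At.gate-induction ρ Determined atRoot outward x y z
      where
      Determined : V → Set
      Determined x = ∀ y z → Corresponds ρ ρ′ x y → Corresponds ρ ρ′ x z → y ≡ z
      atRoot : Determined (vertex ρ)
      atRoot y z s t = trans (proj₁ (corresponds-invariant s) refl)
        (sym (proj₁ (corresponds-invariant t) refl))
      outward : ∀ {x g} → x ≢ vertex ρ → At.Gate ρ (At.down ρ x) g → Determined g → Determined x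
      outward {x} {g} x≢r G unique y z s t = agree (lastStep s x≢r) (lastStep t x≢r)
        where
        D : Lobe Γ
        D = At.down ρ x
        fromD : ∀ {y} (s : LastStep x y) → LastStep.Θ s ≅ D × LastStep.g s ≡ g
        fromD s = Θ≅D , At.gate-unique ρ D (At.gate-cong ρ Θ D Θ≅D (Link.gate link)) G
          where
          open LastStep s
          Θ≅D : Θ ≅ D
          Θ≅D = proj₂ (At.nongate ρ Θ (Link.gate link) (subst (VLobe Θ) x≡ (chart∈ Θ _ point)) x≢g)
        agree : LastStep x y → LastStep x z → y ≡ z
        agree s t = trans (sym S.y≡) (trans
          (links-agree S.link T.link (trans (proj₂ (fromD s)) (sym (proj₂ (fromD t))))
            (unique _ _ (subst (λ h → Corresponds ρ ρ′ h S.g′) (proj₂ (fromD s)) S.before)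
                        (subst (λ h → Corresponds ρ ρ′ h T.g′) (proj₂ (fromD t)) T.before))
            (≅-trans S.Θ D T.Θ (proj₁ (fromD s)) (≅-sym T.Θ D (proj₁ (fromD t))))
            S.point T.point (trans S.x≡ (sym T.x≡)))
          T.y≡)
          where
          module S = LastStep s
          module T = LastStep t

    -- By functionality the partners of both ends can be computed through this one link, where the
    -- charts preserve the edges of the lobe.
    corresponds-edge : ∀ {g g′ Θ Θ′} → Corresponds ρ ρ′ g g′ → Link ρ ρ′ g g′ Θ Θ′ →
      ∀ {x z y w} (x~z : x ~ z) → edge x z x~z ≅ Θ →
      Corresponds ρ ρ′ x y → Corresponds ρ ρ′ z w → Σ[ y~w ∈ y ~ w ] edge y w y~w ≅ Θ′
    corresponds-edge {Θ = Θ} {Θ′} t l {x} {z} {y} {w} x~z e∈Θ s u =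
      transfer (chart-surjective Θ (proj₁ gate) (proj₁ (end∈lobe Θ x~z e∈Θ)))
               (chart-surjective Θ (proj₁ gate) (proj₂ (end∈lobe Θ x~z e∈Θ)))
      where
      open Link l
      transfer : ∃[ p ] at p ≡ x → ∃[ p ] at p ≡ z → Σ[ y~w ∈ y ~ w ] edge y w y~w ≅ Θ′
      transfer (p , p↦x) (p′ , p′↦z) = subst₂ (Joined Θ′)
          (corresponds-functional x (step t l p p↦x refl) s) (corresponds-functional z (step t l p′ p′↦z refl) u)
        (Equivalence.to (Isomorphism.adjacency (chartIso Θ′ (proj₁ gate′)) p p′)
          (Equivalence.from (Isomorphism.adjacency (chartIso Θ (proj₁ gate)) p p′)
            (subst₂ (Joined Θ) (sym p↦x) (sym p′↦z) (x~z , e∈Θ))))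
        where
        Joined : Lobe Γ → V → V → Set
        Joined Φ u v = Σ[ u~v ∈ u ~ v ] edge u v u~v ≅ Φ

    corresponds-adjacent : ∀ {x z y w} → x ~ z → Corresponds ρ ρ′ x y → Corresponds ρ ρ′ z w → y ~ w
    corresponds-adjacent {x} {z} {y} {w} x~z s u = inLobe (At.gate-exists ρ Θ)
      where
      Θ : Lobe Γ
      Θ = edge x z x~z
      inLobe : ∃ (At.Gate ρ Θ) → y ~ w
      inLobe (g , G) = across (corresponds-total g)
        where
        across : ∃[ g′ ] Corresponds ρ ρ′ g g′ → y ~ w
        across (g′ , t) = proj₁ (corresponds-edge t (proj₂ (extend Θ t G)) x~z (≅-refl Θ) s u)

    -- The purpose of taking `down` at the root to be the given lobe: both root lobes receive rank
    -- 0, so the extension carries one onto the other.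
    rootLink : Link ρ ρ′ (vertex ρ) (vertex ρ′) (lobe ρ) (lobe ρ′)
    rootLink with q , l , l′ ← corresponds⇒label-down base = record
      { gate = vertex∈ ρ , inj₁ refl ; gate′ = vertex∈ ρ′ , inj₁ refl
      ; label₁ = subst (λ Θ → HasLabel ρ _ Θ q 0) (At.down-root ρ) l
      ; label₂ = subst (λ Θ → HasLabel ρ′ _ Θ q 0) (At.down-root ρ′) l′
      }

  module _ {ρ ρ′ : Root} (compatible : Alike (lobe ρ) (vertex ρ) (lobe ρ′) (vertex ρ′)) where

    private
      compatible′ : Alike (lobe ρ′) (vertex ρ′) (lobe ρ) (vertex ρ)
      compatible′ = alike-sym _ _ _ _ compatible

      forth back : V → V
      forth x = proj₁ (corresponds-total {ρ} {ρ′} compatible x)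
      back y  = proj₁ (corresponds-total {ρ′} {ρ} compatible′ y)

      corresponds-forth : ∀ x → Corresponds ρ ρ′ x (forth x)
      corresponds-forth x = proj₂ (corresponds-total {ρ} {ρ′} compatible x)

      corresponds-back : ∀ y → Corresponds ρ′ ρ y (back y)
      corresponds-back y = proj₂ (corresponds-total {ρ′} {ρ} compatible′ y)

    extension : Aut Γ
    extension = record
      { bijection = mk↔ₛ′ forth back
          (λ y → corresponds-functional {ρ} {ρ′} compatible (back y)
            (corresponds-forth (back y)) (corresponds-sym (corresponds-back y)))
          (λ x → corresponds-functional {ρ′} {ρ} compatible′ (forth x)
            (corresponds-back (forth x)) (corresponds-sym (corresponds-forth x)))
      ; adjacency = λ u v → mk⇔
          (λ u~v → corresponds-adjacent {ρ} {ρ′} compatible u~v (corresponds-forth u) (corresponds-forth v))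
          (λ fu~fv → corresponds-adjacent {ρ′} {ρ} compatible′ fu~fv
            (corresponds-sym (corresponds-forth u)) (corresponds-sym (corresponds-forth v)))
      }

    extension-mapsOnto : MapsOnto extension (lobe ρ) (lobe ρ′)
    extension-mapsOnto (edge u v u~v) = mk⇔
      (λ e∈Λ → proj₂ (corresponds-edge {ρ} {ρ′} compatible base (rootLink compatible) u~v e∈Λ
        (corresponds-forth u) (corresponds-forth v)))
      (λ e∈Λ′ → proj₂ (corresponds-edge {ρ′} {ρ} compatible′ base (rootLink compatible′)
        (corresponds-adjacent {ρ} {ρ′} compatible u~v (corresponds-forth u) (corresponds-forth v)) e∈Λ′
        (corresponds-sym (corresponds-forth u)) (corresponds-sym (corresponds-forth v))))

  lobeTransitive : LobeTransitive Γ
  lobeTransitive Λ Λ′ = extension {ρ} {ρ′} compatible , extension-mapsOnto {ρ} {ρ′} compatible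
    where
    m : VLobe Λ (end₁ Λ)
    m = Λ , ≅-refl Λ , inj₁ refl
    ρ ρ′ : Root
    ρ  = root (end₁ Λ) Λ m
    -- The second root vertex has the same coordinate in `Λ₀` as the first, so the two are of one
    -- type.
    ρ′ = root _ Λ′ (proj₂ (σ.to Λ′ (coord Λ m)))
    compatible : Alike Λ (vertex ρ) Λ′ (vertex ρ′)
    compatible = coord Λ m , coord Λ m , ≈-refl _ , σ-coord Λ m , refl

-- From lobe-transitivity to a family of isomorphisms with constant counts.

module Translates (em : ExcludedMiddle 0ℓ) (Γ : Graph) (connected : Connected Γ)
  (code : Graph.V Γ → ℕ) (code-injective : ∀ {u v} → code u ≡ code v → u ≡ v) (Λ₀ : Lobe Γ)
  (transitive : LobeTransitive Γ) where
  open Graph Γ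
  open Edge
  open LobeTheory em Γ
  open Lobes connected
  open Automorphisms em Γ connected
  open Classical em

  edgeCode : Edge Γ → ℕ
  edgeCode e = pair (code (end₁ e)) (code (end₂ e))

  edgeCode⇒≅ : ∀ e f → edgeCode e ≡ edgeCode f → e ≅ f
  edgeCode⇒≅ e f eq with pair-injective (code (end₁ e)) (code (end₂ e)) (code (end₁ f)) (code (end₂ f)) eq
  ... | p , q = inj₁ (inj₁ (code-injective p , code-injective q))

  abstract
    private
      HasCode : Lobe Γ → ℕ → Set
      HasCode Λ k = Σ[ e ∈ Edge Γ ] e ≅ Λ × edgeCode e ≡ k

      leastCode : ∀ Λ → ∃ (Least (HasCode Λ))
      leastCode Λ = least (edgeCode Λ , Λ , ≅-refl Λ , refl)

      decode : ℕ → Lobe Γ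
      decode k with em {Σ[ e ∈ Edge Γ ] edgeCode e ≡ k}
      ... | yes (e , _) = e
      -- An arbitrary value, taken only at numbers that code no edge.
      ... | no _        = Λ₀

      edgeCode-decode : ∀ e → edgeCode (decode (edgeCode e)) ≡ edgeCode e
      edgeCode-decode e with em {Σ[ f ∈ Edge Γ ] edgeCode f ≡ edgeCode e}
      ... | yes (_ , eq) = eq
      ... | no none      = contradiction (e , refl) none

    lobeCode : Lobe Γ → ℕ
    lobeCode Λ = proj₁ (leastCode Λ)

    lobeCode-cong : ∀ Λ Λ′ → Λ ≅ Λ′ → lobeCode Λ ≡ lobeCode Λ′
    lobeCode-cong Λ Λ′ Λ≅Λ′ = least-unique {HasCode Λ} {HasCode Λ′}
      (λ (e , e≅Λ , p) → e , ≅-trans e Λ Λ′ e≅Λ Λ≅Λ′ , p)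
      (λ (e , e≅Λ′ , p) → e , ≅-trans e Λ′ Λ e≅Λ′ (≅-sym Λ Λ′ Λ≅Λ′) , p)
      (proj₂ (leastCode Λ)) (proj₂ (leastCode Λ′))

    lobeCode-injective : ∀ Λ Λ′ → lobeCode Λ ≡ lobeCode Λ′ → Λ ≅ Λ′
    lobeCode-injective Λ Λ′ eq = meet (proj₁ (proj₂ (leastCode Λ))) (proj₁ (proj₂ (leastCode Λ′)))
      where
      meet : HasCode Λ (lobeCode Λ) → HasCode Λ′ (lobeCode Λ′) → Λ ≅ Λ′
      meet (e , e≅Λ , p) (f , f≅Λ′ , q) = ≅-trans Λ e Λ′ (≅-sym e Λ e≅Λ)
        (≅-trans e f Λ′ (edgeCode⇒≅ e f (trans p (trans eq (sym q)))) f≅Λ′)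

    -- Equal lobes get the same representative, including its adjacency proof, hence
    -- the same automorphism.
    representative : Lobe Γ → Lobe Γ
    representative Λ = decode (lobeCode Λ)

    representative-cong : ∀ Λ Λ′ → Λ ≅ Λ′ → representative Λ ≡ representative Λ′
    representative-cong Λ Λ′ Λ≅Λ′ = cong decode (lobeCode-cong Λ Λ′ Λ≅Λ′)

    representative-≅ : ∀ Λ → representative Λ ≅ Λ
    representative-≅ Λ = decoded (proj₁ (proj₂ (leastCode Λ)))
      where
      decoded : HasCode Λ (lobeCode Λ) → representative Λ ≅ Λ
      decoded (e , e≅Λ , eq) = ≅-trans (representative Λ) e Λ (edgeCode⇒≅ (representative Λ) e
        (subst (λ k → edgeCode (decode k) ≡ edgeCode e) eq (edgeCode-decode e))) e≅Λ

  α : Lobe Γ → Aut Γ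
  α Λ = proj₁ (transitive Λ₀ (representative Λ))

  α-mapsOnto : ∀ Λ → MapsOnto (α Λ) Λ₀ Λ
  α-mapsOnto Λ = mapsOnto-cong (α Λ) Λ₀ (representative Λ) Λ (representative-≅ Λ)
    (proj₂ (transitive Λ₀ (representative Λ)))

  family : IsoFamily Λ₀
  family = record
    { σ = λ Λ → restrictToLobe (α Λ) Λ₀ Λ (α-mapsOnto Λ)
    ; σ-wellDefined = λ Λ Λ′ Λ≅Λ′ x →
        cong (λ Θ → proj₁ (transitive Λ₀ Θ) · proj₁ x) (representative-cong Λ Λ′ Λ≅Λ′)
    }

  open IsoFamily family using (Image; LobesThrough; IsCount)

  Carries : V → Lobe Γ → V → Set
  Carries q Λ v = Σ[ β ∈ Aut Γ ] MapsOnto β Λ₀ Λ × β · q ≡ v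

  through⇒carries : ∀ j Λ {v} → v ∈ Image Λ (Q Λ₀ j) → Carries (proj₁ j) Λ v
  through⇒carries j Λ ((_ , _) , (s , s-maps , refl) , eq) =
    α Λ ∘ᴬ s , mapsOnto-∘ (α Λ) s Λ₀ Λ₀ Λ (α-mapsOnto Λ) s-maps , eq

  -- Two automorphisms taking `Λ₀` to `Λ` differ by an element of the stabilizer, which stays within
  -- the orbit; the choice of `α Λ` therefore does not affect the count.
  carries⇒through : ∀ j Λ {v} → Carries (proj₁ j) Λ v → v ∈ Image Λ (Q Λ₀ j)
  carries⇒through (q , orbit⊆) Λ (β , β-maps , refl) =
    (s · q , orbit⊆ (s , s-maps , refl)) , (s , s-maps , refl) , inverseʳ (α Λ) (β · q)
    where
    s : Aut Γ
    s = (α Λ) ⁻¹ ∘ᴬ β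
    s-maps : MapsOnto s Λ₀ Λ₀
    s-maps = mapsOnto-∘ ((α Λ) ⁻¹) β Λ₀ Λ Λ₀ (mapsOnto-⁻¹ (α Λ) Λ₀ Λ (α-mapsOnto Λ)) β-maps

  translate : ∀ j γ {u v} → γ · u ≡ v → LobesThrough j u → LobesThrough j v
  translate j γ {u} {v} γu≡v (Λ , i) = image γ Λ , carries⇒through j (image γ Λ) (moved (through⇒carries j Λ i))
    where
    moved : Carries (proj₁ j) Λ u → Carries (proj₁ j) (image γ Λ) v
    moved (β , β-maps , βq≡u) = γ ∘ᴬ β , mapsOnto-∘ γ β Λ₀ Λ (image γ Λ) (mapsOnto-image γ Λ) β-maps ,
      trans (cong (γ ·_) βq≡u) γu≡v

  image-reflects-≅ : ∀ γ Λ Λ′ → image γ Λ ≅ image γ Λ′ → Λ ≅ Λ′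
  image-reflects-≅ γ Λ Λ′ = Equivalence.from (mapsOnto-image γ Λ′ Λ)

  Same : ∀ j v → LobesThrough j v → LobesThrough j v → Set
  Same j v Λ Λ′ = proj₁ Λ ≅ proj₁ Λ′

  abstract
    counting : ∀ j v → ∃[ c ] Numbering (LobesThrough j v) (Same j v) c
    counting j v = countable (lobeCode ∘ proj₁)
      (λ {a} {b} → lobeCode-cong (proj₁ a) (proj₁ b)) (λ {a} {b} → lobeCode-injective (proj₁ a) (proj₁ b))

  τ : J Λ₀ → V → ℕ∪ℵ₀
  τ j v = proj₁ (counting j v)

  τ-count : ∀ j → IsCount j (τ j)
  τ-count j v = hasCardinality (τ j v) (proj₂ (counting j v))

  τ-const : ∀ j i u v → u ∈ P Γ i → v ∈ P Γ i → τ j u ≡ τ j v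
  τ-const j i u v (β , _ , refl) (γ , _ , refl) = card-≡ (τ j u) (τ j v)
    (proj₂ (counting j u)) (proj₂ (counting j v))
    (translate j (γ ∘ᴬ β ⁻¹) (cong (γ ·_) (inverseˡ β i)))
    (λ {a} {b} → image-reflects-≅ (γ ∘ᴬ β ⁻¹) (proj₁ a) (proj₁ b))
    (translate j (β ∘ᴬ γ ⁻¹) (cong (β ·_) (inverseˡ γ i)))
    (λ {a} {b} → image-reflects-≅ (β ∘ᴬ γ ⁻¹) (proj₁ a) (proj₁ b))

  τ-positive : ∀ j v → Positive (τ j v) ⇔ (v ∈ PContaining Λ₀ j)
  τ-positive j v = mk⇔
    (λ pos → inOrbit (positive⇒inhabited (τ j v) (proj₂ (counting j v)) pos))
    (λ v∈P → inhabited⇒positive (τ j v) (proj₂ (counting j v)) (lobeThrough v∈P))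
    where
    inOrbit : LobesThrough j v → v ∈ PContaining Λ₀ j
    inOrbit (Λ , i) with through⇒carries j Λ i
    ... | β , _ , eq = β , tt , eq
    lobeThrough : v ∈ PContaining Λ₀ j → LobesThrough j v
    lobeThrough (β , _ , eq) = image β Λ₀ , carries⇒through j (image β Λ₀) (β , mapsOnto-image β Λ₀ , eq)

theorem3p2 :
    ExcludedMiddle 0ℓ →
    (Γ : Graph) → FiniteOrCountable Γ → Connected Γ → ConnectivityOne Γ →
    (Λ₀ : Lobe Γ) →
    LobeTransitive Γ ⇔
      (Σ[ F ∈ IsoFamily Λ₀ ]
        ((j : J Λ₀) →
          Σ[ τ ∈ (Graph.V Γ → ℕ∪ℵ₀) ]
            IsoFamily.IsCount F j τ
            × (∀ i u v → u ∈ P Γ i → v ∈ P Γ i → τ u ≡ τ v)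
            × (∀ v → Positive (τ v) ⇔ (v ∈ PContaining Λ₀ j))))
theorem3p2 em Γ (c , card) connected _ Λ₀ = mk⇔
  (λ transitive → let open Translates em Γ connected index injective Λ₀ transitive in
    family , λ j → τ j , τ-count j , τ-const j , τ-positive j)
  (λ (F , counts) → Extension.lobeTransitive em Γ connected index injective Λ₀ F
    (λ j → proj₁ (counts j))
    (λ j → proj₁ (proj₂ (counts j)))
    (λ j → proj₁ (proj₂ (proj₂ (counts j))))
    (λ j v → Equivalence.to (proj₂ (proj₂ (proj₂ (counts j))) v)))
  where open Numbering (numbering (λ _ → refl) c card)
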